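{- Let $\Pi$ be a projective plane of order $p^2$, where $p\geq 7$ is prime. There is no non-zero code word $c\in\mathrm{C}(\Pi)^\perp$ of weight at most $2p^2-2p+4$ that uses more than $2$ distinct non-zero symbols of $\mathbb{F}_p$.
   Context: $\mathrm{C}(\Pi)$ is the $\mathbb{F}_p$-span of the incidence vectors of the lines of $\Pi$, viewed as vectors in $\mathbb{F}_p^{p^4+p^2+1}$ indexed by the points of $\Pi$; $\mathrm{C}(\Pi)^\perp$ is the set of vectors $v$ with $\sum_{P\in\ell}v_P=0$ in $\mathbb{F}_p$ for every line $\ell$ of $\Pi$. The weight of a vector is its number of non-zero positions. -}

module Defs where

open import Data.Nat using (ℕ; zero; suc; _+_; _*_; _^_; _%_; _∸_; _≤_)
open import Data.Fin using (Fin; toℕ)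
open import Data.Bool using (Bool; true; false; if_then_else_)
open import Data.List using (List; map; allFin)
open import Data.Nat.ListAction using (sum)
open import Data.Nat.Divisibility using (_∣_)
open import Data.Product using (Σ; _×_; ∃-syntax)
open import Relation.Binary.PropositionalEquality using (_≡_; _≢_)

count : (N : ℕ) → (Fin N → Bool) → ℕ
count N f = sum (map (λ x → if f x then 1 else 0) (allFin N))

numPts : ℕ → ℕ
numPts n = n * n + n + 1

-- A projective plane of order n, with points and lines both indexed by
-- Fin (n^2+n+1); 'inc P ℓ ≡ true' means the point P lies on the line ℓ.
record ProjectivePlane (n : ℕ) : Set where
  field
    inc : Fin (numPts n) → Fin (numPts n) → Bool
    line-unique : ∀ P Q → P ≢ Q →
      ∃[ ℓ ] (inc P ℓ ≡ true × inc Q ℓ ≡ true ×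
              (∀ m → inc P m ≡ true → inc Q m ≡ true → m ≡ ℓ))
    point-unique : ∀ ℓ m → ℓ ≢ m →
      ∃[ P ] (inc P ℓ ≡ true × inc P m ≡ true ×
              (∀ Q → inc Q ℓ ≡ true → inc Q m ≡ true → Q ≡ P))
    line-size : ∀ ℓ → count (numPts n) (λ P → inc P ℓ) ≡ suc n

module _ {n : ℕ} (Π : ProjectivePlane n) where
  open ProjectivePlane Π

  -- vectors over F_p indexed by points; F_p is represented by Fin p
  -- (the value x ∈ Fin p stands for toℕ x mod p).
  Word : ℕ → Set
  Word p = Fin (numPts n) → Fin p

  lineSum : {p : ℕ} → Word p → Fin (numPts n) → ℕ
  lineSum c ℓ = sum (map (λ P → if inc P ℓ then toℕ (c P) else 0) (allFin (numPts n)))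

  -- c ∈ C(Π)^⊥ : for every line, the sum of entries is 0 in F_p
  InDual : (p : ℕ) → Word p → Set
  InDual p c = ∀ ℓ → p ∣ lineSum c ℓ

isZero : ℕ → Bool
isZero zero = true
isZero (suc _) = false

weight : {N p : ℕ} → (Fin N → Fin p) → ℕ
weight {N} c = count N (λ P → if isZero (toℕ (c P)) then false else true)

NonZeroWord : {N p : ℕ} → (Fin N → Fin p) → Set
NonZeroWord {N} c = ∃[ P ] (toℕ (c P) ≢ 0)

UsesMoreThanTwoSymbols : {N p : ℕ} → (Fin N → Fin p) → Set
UsesMoreThanTwoSymbols {N} c =
  ∃[ P ] ∃[ Q ] ∃[ R ]
    (toℕ (c P) ≢ 0 × toℕ (c Q) ≢ 0 × toℕ (c R) ≢ 0 ×
     c P ≢ c Q × c P ≢ c R × c Q ≢ c R)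

{-# OPTIONS --safe #-}
-- Write s_x for the number of points with symbol x, w for the weight, q = p². Summing a function f of the symbols
-- over the q + 1 lines through a point P counts every point once and P itself q extra times, so any lower bound for
-- f on zero-sum multisets of symbols gives a linear inequality between the s_x (Pencil); summing a product of two
-- functions over all lines works in the same way (AllLines).
--
-- Such inequalities give 2p − 1 ≤ s_x for every symbol x that occurs, and, after scaling x to 1, that the least
-- further symbol is 2 (this needs a symbol other than ±x). Hence the occurring symbols are closed under doubling,
-- which bounds s_x by 2p + 4, and then w ≥ 2q − 2p + 2 forces every non-zero symbol to occur.
--
-- For a line ℓ let m be the number of its support points and n_x the number of those with symbol x. Lines with m = 3
-- satisfy n_{−2x} = n_x − 1 whenever n_x > 0, whereas Σ_x (s_{−2x} − s_x + 1) = p − 1 > 0, so lines with m ≥ 4 are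
-- needed; but these are too few. Precisely, with weights ω_x proportional to 1/s_x,
--   Σ_x ω_x n_x (31 (m − 3 + n_{−x}) − 52 (n_{−2x} + 1 − n_x)) ≥ 0
-- on every line, while the sum over all lines is a positive multiple of a number at most 145 − 21p < 0.
module Submission where

open import Defs
import Data.Fin.Properties as Fin
import Data.Integer.Properties as ℤ
import Data.List.Properties as List
import Data.List.Relation.Unary.Any as Any
import Data.Nat as ℕ
import Data.Nat.ListAction as ℕ
import Data.Nat.Properties as ℕ

module DualWord where
  open import Algebra.Properties.Semiring.Sum ℤ.+-*-semiring
    using (sum; sum-cong-≗; ∑-distrib-+; ∑-comm; *-distribˡ-sum; *-distribʳ-sum)
  open import Data.Bool using (Bool; true; false; if_then_else_)
  open import Data.Empty using (⊥; ⊥-elim)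
  open import Data.Fin using (Fin; zero; suc; toℕ; fromℕ<)
  open import Data.Integer using (ℤ; +_; -[1+_]; -_; _+_; _-_; _*_; _≤_; _<_; ∣_∣; 0ℤ; 1ℤ; +≤+; +<+; -<+; positive)
  open import Data.Integer.Divisibility.Signed
    using (∣ᵤ⇒∣; ∣⇒∣ᵤ; ∣m∣n⇒∣m+n; ∣n⇒∣m*n; ∣m⇒∣-m; ∣m∣n⇒∣m-n; ∣-refl)
    renaming (_∣_ to _∣ᶻ_; divides to dividesᶻ)
  open import Data.Integer.Tactic.RingSolver using (solve-∀)
  open import Data.List using (List; []; _∷_; map; allFin; tabulate)
  open import Data.List.Membership.DecPropositional ℕ._≟_ using (_∈?_)
  open import Data.List.Membership.Propositional using (_∈_; find; lose)
  open import Data.List.Membership.Propositional.Properties using (∈-map⁺; ∈-map⁻)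
  open import Data.List.Relation.Binary.Permutation.Propositional using (_↭_; prep; swap)
    renaming (refl to ↭-refl; trans to ↭-trans)
  open import Data.List.Relation.Unary.Any using (here; there)
  open import Data.Nat using (ℕ; zero; suc; _!)
  open import Data.Nat.Coprimality using (prime⇒coprime; coprime-Bézout)
  open import Data.Nat.Divisibility using (_∣_; ∣⇒≤; m≤n⇒m!∣n!; m∣m*n; ∣-trans)
  open import Data.Nat.DivMod using (m≡m%n+[m/n]*n; m%n<n; m/n*n≡m)
  open import Data.Nat.GCD using (module Bézout)
  open import Data.Nat.Induction using (<-rec)
  open import Data.Nat.Primality using (Prime; euclidsLemma; prime⇒nonZero)
  open import Data.Product using (∃-syntax; _×_; _,_; proj₁; proj₂)
  open import Data.Sum using (_⊎_; inj₁; inj₂)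
  open import Function using (_∘_; id)
  open import Relation.Binary.Definitions using (tri<; tri≈; tri>)
  open import Relation.Binary.PropositionalEquality
  open import Relation.Nullary using (¬_; Dec; yes; no; does; contradiction)
  open import Relation.Nullary.Decidable using (_×-dec_)

  -- Finite sums of integers.

  𝟙 : Bool → ℤ
  𝟙 true  = 1ℤ
  𝟙 false = 0ℤ

  sum-mono : ∀ {N} (f g : Fin N → ℤ) → (∀ i → f i ≤ g i) → sum f ≤ sum g
  sum-mono {zero}  f g f≤g = ℤ.≤-refl
  sum-mono {suc N} f g f≤g = ℤ.+-mono-≤ (f≤g zero) (sum-mono (f ∘ suc) (g ∘ suc) (f≤g ∘ suc))

  sum-zero : ∀ {N} (f : Fin N → ℤ) → (∀ i → f i ≡ 0ℤ) → sum f ≡ 0ℤ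
  sum-zero {zero}  f f≡0 = refl
  sum-zero {suc N} f f≡0 = cong₂ _+_ (f≡0 zero) (sum-zero (f ∘ suc) (f≡0 ∘ suc))

  sum-single : ∀ {N} (f : Fin N → ℤ) i → (∀ j → j ≢ i → f j ≡ 0ℤ) → sum f ≡ f i
  sum-single f zero    f≡0 = trans (cong (_+_ (f zero)) (sum-zero (f ∘ suc) (λ j → f≡0 (suc j) λ ()))) (ℤ.+-identityʳ _)
  sum-single f (suc i) f≡0 = trans (cong₂ _+_ (f≡0 zero λ ())
    (sum-single (f ∘ suc) i (λ j j≢i → f≡0 (suc j) (j≢i ∘ Fin.suc-injective)))) (ℤ.+-identityˡ _)

  sum-const : ∀ N x → sum {N} (λ _ → x) ≡ + N * x
  sum-const zero    x = refl
  sum-const (suc N) x = trans (cong (_+_ x) (sum-const N x)) (lemma x (+ N))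
    where
    lemma : ∀ x n → x + n * x ≡ (1ℤ + n) * x
    lemma = solve-∀

  sum-allFin : ∀ {N} (g : Fin N → ℕ) → + ℕ.sum (map g (allFin N)) ≡ sum (+_ ∘ g)
  sum-allFin g = trans (cong (λ l → + ℕ.sum l) (List.map-tabulate id g)) (sum-tabulate g)
    where
    sum-tabulate : ∀ {N} (g : Fin N → ℕ) → + ℕ.sum (tabulate g) ≡ sum (+_ ∘ g)
    sum-tabulate {zero}  g = refl
    sum-tabulate {suc N} g = trans (ℤ.pos-+ (g zero) _) (cong (_+_ (+ g zero)) (sum-tabulate (g ∘ suc)))

  -- Counting incidences in a projective plane.

  module Incidence {n : ℕ} (Π : ProjectivePlane n) .{{_ : ℕ.NonZero n}} where
    open ProjectivePlane Π

    private
      N = numPts n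

    I : Fin N → Fin N → ℤ
    I P ℓ = 𝟙 (inc P ℓ)

    δ : Fin N → Fin N → ℤ
    δ P Q = 𝟙 (does (P Fin.≟ Q))

    sum-δ : ∀ P (f : Fin N → ℤ) → sum (λ Q → δ P Q * f Q) ≡ f P
    sum-δ P f = trans (sum-single _ P off) on
      where
      off : ∀ Q → Q ≢ P → δ P Q * f Q ≡ 0ℤ
      off Q Q≢P with P Fin.≟ Q
      ... | yes P≡Q = contradiction (sym P≡Q) Q≢P
      ... | no  _   = refl
      on : δ P P * f P ≡ f P
      on with P Fin.≟ P
      ... | yes _   = ℤ.*-identityˡ (f P)
      ... | no  P≢P = contradiction refl P≢P

    joining : ∀ P Q → P ≢ Q → sum (λ ℓ → I P ℓ * I Q ℓ) ≡ 1ℤ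
    joining P Q P≢Q with line-unique P Q P≢Q
    ... | ℓ₀ , P∈ℓ₀ , Q∈ℓ₀ , unique = trans (sum-single _ ℓ₀ off) (cong₂ (λ a b → 𝟙 a * 𝟙 b) P∈ℓ₀ Q∈ℓ₀)
      where
      off : ∀ ℓ → ℓ ≢ ℓ₀ → I P ℓ * I Q ℓ ≡ 0ℤ
      off ℓ ℓ≢ℓ₀ with inc P ℓ in P∈ℓ | inc Q ℓ in Q∈ℓ
      ... | false | _     = refl
      ... | true  | false = refl
      ... | true  | true  = contradiction (unique ℓ P∈ℓ Q∈ℓ) ℓ≢ℓ₀

    points-on : ∀ ℓ → sum (λ P → I P ℓ) ≡ + suc n
    points-on ℓ = trans (sum-cong-≗ (λ P → step (inc P ℓ)))
      (trans (sym (sum-allFin (λ P → if inc P ℓ then 1 else 0))) (cong +_ (line-size ℓ)))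
      where
      step : ∀ b → 𝟙 b ≡ + (if b then 1 else 0)
      step true  = refl
      step false = refl

    I-idem : ∀ P ℓ → I P ℓ * I P ℓ ≡ I P ℓ
    I-idem P ℓ with inc P ℓ
    ... | true  = refl
    ... | false = refl

    -- Flags (Q, ℓ) with ℓ through P are counted in two ways: each of the d lines has n + 1 points,
    -- while every Q ≠ P lies on one of the lines and P on all d. So d (n + 1) = N + (d - 1), that
    -- is, n d = n (n + 1).
    lines-through : ∀ P → sum (I P) ≡ + suc n
    lines-through P = ℤ.*-cancelˡ-≡ (+ n) d (+ suc n) (solved d double-count)
      where
      open ≡-Reasoning
      d = sum (I P)
      common : ∀ Q → sum (λ ℓ → I P ℓ * I Q ℓ) ≡ 1ℤ + δ P Q * (d - 1ℤ)
      common Q with P Fin.≟ Q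
      ... | yes refl = trans (sum-cong-≗ (I-idem P)) (lemma d)
        where
        lemma : ∀ d → d ≡ 1ℤ + 1ℤ * (d - 1ℤ)
        lemma = solve-∀
      ... | no P≢Q = joining P Q P≢Q
      double-count : d * + suc n ≡ + N * 1ℤ + (d - 1ℤ)
      double-count = begin
        d * + suc n                                        ≡⟨ *-distribʳ-sum (+ suc n) (I P) ⟩
        sum (λ ℓ → I P ℓ * + suc n)                        ≡⟨ sum-cong-≗ (λ ℓ → cong (I P ℓ *_) (points-on ℓ)) ⟨
        sum (λ ℓ → I P ℓ * sum (λ Q → I Q ℓ))              ≡⟨ sum-cong-≗ (λ ℓ → *-distribˡ-sum (I P ℓ) (λ Q → I Q ℓ)) ⟩
        sum (λ ℓ → sum (λ Q → I P ℓ * I Q ℓ))              ≡⟨ ∑-comm (λ ℓ Q → I P ℓ * I Q ℓ) ⟩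
        sum (λ Q → sum (λ ℓ → I P ℓ * I Q ℓ))              ≡⟨ sum-cong-≗ common ⟩
        sum (λ Q → 1ℤ + δ P Q * (d - 1ℤ))                  ≡⟨ ∑-distrib-+ (λ _ → 1ℤ) (λ Q → δ P Q * (d - 1ℤ)) ⟩
        sum {N} (λ _ → 1ℤ) + sum (λ Q → δ P Q * (d - 1ℤ))  ≡⟨ cong₂ _+_ (sum-const N 1ℤ) (sum-δ P (λ _ → d - 1ℤ)) ⟩
        + N * 1ℤ + (d - 1ℤ)                                ∎
      N-def : + N ≡ + n * + n + + n + 1ℤ
      N-def = trans (ℤ.pos-+ (n ℕ.* n ℕ.+ n) 1) (cong (_+ 1ℤ) (trans (ℤ.pos-+ (n ℕ.* n) n) (cong (_+ + n)
            (ℤ.pos-* n n))))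
      solved : ∀ d → d * + suc n ≡ + N * 1ℤ + (d - 1ℤ) → + n * d ≡ + n * + suc n
      solved d eq = trans (lemma₁ d (+ n)) (trans (cong (_- d) eq) (trans (cong (λ k → k * 1ℤ +
            (d - 1ℤ) - d) N-def) (lemma₂ d (+ n))))
        where
        lemma₁ : ∀ d n → n * d ≡ d * (1ℤ + n) - d
        lemma₁ = solve-∀
        lemma₂ : ∀ d n → (n * n + n + 1ℤ) * 1ℤ + (d - 1ℤ) - d ≡ n * (1ℤ + n)
        lemma₂ = solve-∀

    common-lines : ∀ P Q → sum (λ ℓ → I P ℓ * I Q ℓ) ≡ 1ℤ + + n * δ P Q
    common-lines P Q with P Fin.≟ Q
    ... | yes refl = trans (sum-cong-≗ (I-idem P)) (trans (lines-through P) (cong (_+_ 1ℤ) (sym (ℤ.*-identityʳ (+ n)))))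
    ... | no P≢Q   = trans (joining P Q P≢Q) (cong (_+_ 1ℤ) (sym (ℤ.*-zeroʳ (+ n))))

    pencil-sum : ∀ P (f : Fin N → ℤ) →
      sum (λ ℓ → I P ℓ * sum (λ Q → I Q ℓ * f Q)) ≡ sum f + + n * f P
    pencil-sum P f = begin
      sum (λ ℓ → I P ℓ * sum (λ Q → I Q ℓ * f Q))    ≡⟨ sum-cong-≗ (λ ℓ → *-distribˡ-sum (I P ℓ) (λ Q → I Q ℓ * f Q)) ⟩
      sum (λ ℓ → sum (λ Q → I P ℓ * (I Q ℓ * f Q)))  ≡⟨ ∑-comm (λ ℓ Q → I P ℓ * (I Q ℓ * f Q)) ⟩
      sum (λ Q → sum (λ ℓ → I P ℓ * (I Q ℓ * f Q)))  ≡⟨ sum-cong-≗ inner ⟩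
      sum (λ Q → f Q + δ P Q * (+ n * f Q))          ≡⟨ ∑-distrib-+ f (λ Q → δ P Q * (+ n * f Q)) ⟩
      sum f + sum (λ Q → δ P Q * (+ n * f Q))        ≡⟨ cong (_+_ (sum f)) (sum-δ P (λ Q → + n * f Q)) ⟩
      sum f + + n * f P                              ∎
      where
      open ≡-Reasoning
      lemma : ∀ n d x → (1ℤ + n * d) * x ≡ x + d * (n * x)
      lemma = solve-∀
      inner : ∀ Q → sum (λ ℓ → I P ℓ * (I Q ℓ * f Q)) ≡ f Q + δ P Q * (+ n * f Q)
      inner Q = begin
        sum (λ ℓ → I P ℓ * (I Q ℓ * f Q))  ≡⟨ sum-cong-≗ (λ ℓ → ℤ.*-assoc (I P ℓ) (I Q ℓ) (f Q)) ⟨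
        sum (λ ℓ → I P ℓ * I Q ℓ * f Q)    ≡⟨ *-distribʳ-sum (f Q) (λ ℓ → I P ℓ * I Q ℓ) ⟨
        sum (λ ℓ → I P ℓ * I Q ℓ) * f Q    ≡⟨ cong (_* f Q) (common-lines P Q) ⟩
        (1ℤ + + n * δ P Q) * f Q           ≡⟨ lemma (+ n) (δ P Q) (f Q) ⟩
        f Q + δ P Q * (+ n * f Q)          ∎

  -- From words on the plane to lists of symbols.

  lsum : (ℕ → ℤ) → List ℕ → ℤ
  lsum f []       = 0ℤ
  lsum f (x ∷ xs) = f x + lsum f xs

  lsum-id : ∀ xs → lsum (+_) xs ≡ + ℕ.sum xs
  lsum-id []       = refl
  lsum-id (x ∷ xs) = trans (cong (_+_ (+ x)) (lsum-id xs)) (sym (ℤ.pos-+ x (ℕ.sum xs)))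

  -- Zero symbols are dropped, so a list has one entry per support point. The geometry reaches the
  -- later arguments only through such lists, by way of `Pencil` and `AllLines`.
  values : ∀ {N} → (Fin N → Bool) → (Fin N → ℕ) → List ℕ
  values {zero}  b v = []
  values {suc N} b v = add (b zero) (v zero) (values (b ∘ suc) (v ∘ suc))
    where
    add : Bool → ℕ → List ℕ → List ℕ
    add true  (suc x) xs = suc x ∷ xs
    add true  zero    xs = xs
    add false _       xs = xs

  onNonZero : (ℕ → ℤ) → ℕ → ℤ
  onNonZero f zero    = 0ℤ
  onNonZero f (suc x) = f (suc x)

  lsum-values : ∀ {N} f (b : Fin N → Bool) v → lsum f (values b v) ≡ sum (λ i → 𝟙 (b i) * onNonZero f (v i))
  lsum-values {zero}  f b v = refl
  lsum-values {suc N} f b v with b zero | v zero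
  ... | true  | suc x = cong₂ _+_ (sym (ℤ.*-identityˡ (f (suc x)))) (lsum-values f (b ∘ suc) (v ∘ suc))
  ... | true  | zero  = trans (lsum-values f (b ∘ suc) (v ∘ suc)) (sym (ℤ.+-identityˡ _))
  ... | false | _     = trans (lsum-values f (b ∘ suc) (v ∘ suc)) (sym (ℤ.+-identityˡ _))

  ∈-values⁺ : ∀ {N} (b : Fin N → Bool) v i → b i ≡ true → v i ≢ 0 → v i ∈ values b v
  ∈-values⁺ b v zero bi vi≢0 with b zero | v zero
  ... | true  | suc x = here refl
  ... | true  | zero  = contradiction refl vi≢0
  ∈-values⁺ b v (suc i) bi vi≢0 with b zero | v zero
  ... | true  | suc x = there (∈-values⁺ (b ∘ suc) (v ∘ suc) i bi vi≢0)
  ... | true  | zero  = ∈-values⁺ (b ∘ suc) (v ∘ suc) i bi vi≢0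
  ... | false | _     = ∈-values⁺ (b ∘ suc) (v ∘ suc) i bi vi≢0

  ∈-values⁻ : ∀ {N} (b : Fin N → Bool) v {x} → x ∈ values b v → ∃[ i ] (b i ≡ true × v i ≡ x × x ≢ 0)
  ∈-values⁻ {suc N} b v x∈ with b zero in b₀ | v zero in v₀ | x∈
  ... | true  | suc x | here refl = zero , b₀ , v₀ , λ ()
  ... | true  | suc x | there x∈′ = let i , r = ∈-values⁻ (b ∘ suc) (v ∘ suc) x∈′ in suc i , r
  ... | true  | zero  | x∈′       = let i , r = ∈-values⁻ (b ∘ suc) (v ∘ suc) x∈′ in suc i , r
  ... | false | _     | x∈′       = let i , r = ∈-values⁻ (b ∘ suc) (v ∘ suc) x∈′ in suc i , r

  InRange : ℕ → ℕ → Set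
  InRange p x = 0 ℕ.< x × x ℕ.< p

  record ZeroSum (p : ℕ) (xs : List ℕ) : Set where
    field
      range   : ∀ {x} → x ∈ xs → InRange p x
      divides : p ∣ ℕ.sum xs

  -- "all" lists the non-zero symbols of a dual code word, and the lists xs are the restrictions
  -- of the word to the lines through a point carrying the symbol x.
  Pencil : ℕ → List ℕ → Set
  Pencil p all = ∀ {x} → x ∈ all → ∀ (f : ℕ → ℤ) t →
    (∀ xs → ZeroSum p xs → x ∈ xs → (∀ {y} → y ∈ xs → y ∈ all) → t ≤ lsum f xs) →
    t * + suc (p ℕ.* p) ≤ lsum f all + + (p ℕ.* p) * f x

  -- `B` is the quadratic and `C` the linear part of a functional on lines. Two distinct points
  -- share one line and a point lies on q + 1 lines, whence the q extra copies of `B x x` and the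
  -- factor q + 1 at `C x`.
  AllLines : ℕ → List ℕ → Set
  AllLines p all = ∀ (B : ℕ → ℕ → ℤ) (C : ℕ → ℤ) →
    (∀ xs → ZeroSum p xs → 0ℤ ≤ lsum (λ x → lsum (B x) xs - C x) xs) →
    0ℤ ≤ lsum (λ x → lsum (B x) all + + (p ℕ.* p) * B x x - C x * + suc (p ℕ.* p)) all

  module Code {p : ℕ} .{{_ : ℕ.NonZero p}} (Π : ProjectivePlane (p ℕ.* p))
    (c : Fin (numPts (p ℕ.* p)) → Fin p) (c⊥ : InDual Π p c) where
    private instance
      pp≢0 : ℕ.NonZero (p ℕ.* p)
      pp≢0 = ℕ.m*n≢0 p p
    open ProjectivePlane Π
    open Incidence Π

    private
      N = numPts (p ℕ.* p)

    v : Fin N → ℕ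
    v P = toℕ (c P)

    all : List ℕ
    all = values (λ _ → true) v

    line : Fin N → List ℕ
    line ℓ = values (λ P → inc P ℓ) v

    lsum-all : ∀ f → lsum f all ≡ sum (λ P → onNonZero f (v P))
    lsum-all f = trans (lsum-values f (λ _ → true) v) (sum-cong-≗ {N} (λ P → ℤ.*-identityˡ (onNonZero f (v P))))

    lsum-one : + weight c ≡ lsum (λ _ → 1ℤ) all
    lsum-one = trans (sum-allFin (λ P → if (if isZero (v P) then false else true) then 1 else 0))
      (trans (sum-cong-≗ {N} (λ P → step (v P))) (sym (lsum-all _)))
      where
      step : ∀ x → + (if (if isZero x then false else true) then 1 else 0) ≡ onNonZero (λ _ → 1ℤ) x
      step zero    = refl
      step (suc x) = refl

    ∈-all⁺ : ∀ P → v P ≢ 0 → v P ∈ all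
    ∈-all⁺ P = ∈-values⁺ _ v P refl

    all-range : ∀ {x} → x ∈ all → InRange p x
    all-range x∈ with ∈-values⁻ _ v x∈
    ... | P , _ , refl , x≢0 = ℕ.n≢0⇒n>0 x≢0 , Fin.toℕ<n (c P)

    line⊆all : ∀ ℓ {x} → x ∈ line ℓ → x ∈ all
    line⊆all ℓ x∈ with ∈-values⁻ _ v x∈
    ... | P , _ , refl , x≢0 = ∈-all⁺ P x≢0

    line-sum : ∀ ℓ → ℕ.sum (line ℓ) ≡ lineSum Π c ℓ
    line-sum ℓ = ℤ.+-injective (trans (sym (lsum-id (line ℓ))) (trans (lsum-values +_ _ v)
      (trans (sum-cong-≗ {N} (λ P → step (inc P ℓ) (v P))) (sym (sum-allFin (λ P → if inc P ℓ then v P else 0))))))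
      where
      step : ∀ b x → 𝟙 b * onNonZero +_ x ≡ + (if b then x else 0)
      step true  zero    = refl
      step true  (suc x) = ℤ.*-identityˡ (+ suc x)
      step false x       = refl

    line-zeroSum : ∀ ℓ → ZeroSum p (line ℓ)
    line-zeroSum ℓ = record
      { range   = all-range ∘ line⊆all ℓ
      ; divides = subst (p ∣_) (sym (line-sum ℓ)) (c⊥ ℓ)
      }

    lsum-lines : ∀ P f → sum (λ ℓ → I P ℓ * lsum f (line ℓ)) ≡ lsum f all + + (p ℕ.* p) * onNonZero f (v P)
    lsum-lines P f = trans (sum-cong-≗ (λ ℓ → cong (_*_ (I P ℓ)) (lsum-values f _ v)))
      (trans (pencil-sum P (λ Q → onNonZero f (v Q))) (cong (_+ + (p ℕ.* p) * onNonZero f (v P)) (sym (lsum-all f))))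

    sum-lines-const : ∀ P t → sum (λ ℓ → I P ℓ * t) ≡ t * + suc (p ℕ.* p)
    sum-lines-const P t = trans (sym (*-distribʳ-sum t (I P)))
      (trans (cong (_* t) (lines-through P)) (ℤ.*-comm _ t))

    pencil : Pencil p all
    pencil x∈ f t bound with ∈-values⁻ _ v x∈
    ... | P , _ , refl , x≢0 = subst₂ _≤_ (sum-lines-const P t)
      (trans (lsum-lines P f) (cong (λ y → lsum f all + + (p ℕ.* p) * y) (nonZero (v P) x≢0)))
      (sum-mono _ _ step)
      where
      nonZero : ∀ x → x ≢ 0 → onNonZero f x ≡ f x
      nonZero zero    x≢0 = contradiction refl x≢0
      nonZero (suc x) x≢0 = refl
      step : ∀ ℓ → I P ℓ * t ≤ I P ℓ * lsum f (line ℓ)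
      step ℓ with inc P ℓ in P∈ℓ
      ... | false = ℤ.≤-refl
      ... | true  = ℤ.*-monoˡ-≤-nonNeg 1ℤ
        (bound (line ℓ) (line-zeroSum ℓ) (∈-values⁺ _ v P P∈ℓ x≢0) (line⊆all ℓ))

    allLines : AllLines p all
    allLines B C bound = subst₂ _≤_ (sum-zero {N} _ (λ _ → refl)) total
      (sum-mono {N} (λ _ → 0ℤ) (λ ℓ → lsum (g ℓ) (line ℓ)) (λ ℓ → bound (line ℓ) (line-zeroSum ℓ)))
      where
      open ≡-Reasoning
      g : Fin N → ℕ → ℤ
      g ℓ x = lsum (B x) (line ℓ) - C x
      G : ℕ → ℤ
      G x = lsum (B x) all + + (p ℕ.* p) * B x x - C x * + suc (p ℕ.* p)
      distrib : ∀ a l c → a * (l - c) ≡ a * l + a * (- c)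
      distrib = solve-∀
      tidy : ∀ c n → - c * n ≡ - (c * n)
      tidy = solve-∀
      -- For a fixed point the inner sum runs over its pencil, so `lsum-lines` applies to `B x` with
      -- x the symbol of that point.
      at : ∀ P x → v P ≡ x → sum (λ ℓ → I P ℓ * onNonZero (g ℓ) x) ≡ onNonZero G x
      at P zero    _    = sum-zero _ (λ ℓ → ℤ.*-zeroʳ (I P ℓ))
      at P (suc x) vP≡x = begin
        sum (λ ℓ → I P ℓ * (lsum (B x′) (line ℓ) - C x′))
          ≡⟨ sum-cong-≗ (λ ℓ → distrib (I P ℓ) (lsum (B x′) (line ℓ)) (C x′)) ⟩
        sum (λ ℓ → I P ℓ * lsum (B x′) (line ℓ) + I P ℓ * (- C x′))
          ≡⟨ ∑-distrib-+ (λ ℓ → I P ℓ * lsum (B x′) (line ℓ)) (λ ℓ → I P ℓ * (- C x′)) ⟩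
        sum (λ ℓ → I P ℓ * lsum (B x′) (line ℓ)) + sum (λ ℓ → I P ℓ * (- C x′))
          ≡⟨ cong₂ _+_ (lsum-lines P (B x′)) (trans (sum-lines-const P (- C x′)) (tidy (C x′) _)) ⟩
        lsum (B x′) all + + (p ℕ.* p) * onNonZero (B x′) (v P) - C x′ * + suc (p ℕ.* p)
          ≡⟨ cong (λ y → lsum (B x′) all + + (p ℕ.* p) * onNonZero (B x′) y - C x′ * + suc (p ℕ.* p)) vP≡x ⟩
        G x′ ∎
        where x′ = suc x
      total : sum (λ ℓ → lsum (g ℓ) (line ℓ)) ≡ lsum G all
      total = begin
        sum (λ ℓ → lsum (g ℓ) (line ℓ))                        ≡⟨ sum-cong-≗ (λ ℓ → lsum-values (g ℓ) _ v) ⟩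
        sum (λ ℓ → sum (λ P → I P ℓ * onNonZero (g ℓ) (v P)))  ≡⟨ ∑-comm (λ ℓ P → I P ℓ * onNonZero (g ℓ) (v P)) ⟩
        sum (λ P → sum (λ ℓ → I P ℓ * onNonZero (g ℓ) (v P)))  ≡⟨ sum-cong-≗ (λ P → at P (v P) refl) ⟩
        sum (λ P → onNonZero G (v P))                          ≡⟨ lsum-all G ⟨
        lsum G all                                             ∎

  -- Integer inequalities and multiplicities in lists.

  nonNeg-+ : ∀ {a b} → 0ℤ ≤ a → 0ℤ ≤ b → 0ℤ ≤ a + b
  nonNeg-+ = ℤ.+-mono-≤

  nonNeg-* : ∀ {a b} → 0ℤ ≤ a → 0ℤ ≤ b → 0ℤ ≤ a * b
  nonNeg-* {+ a} {+ b} _ _ = subst (_≤_ 0ℤ) (ℤ.pos-* a b) (+≤+ ℕ.z≤n)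

  nonNeg-square : ∀ a → 0ℤ ≤ a * a
  nonNeg-square (+ n)    = nonNeg-* {+ n} {+ n} (+≤+ ℕ.z≤n) (+≤+ ℕ.z≤n)
  nonNeg-square -[1+ n ] = +≤+ ℕ.z≤n

  nat : ∀ n → 0ℤ ≤ + n
  nat n = +≤+ ℕ.z≤n

  ≤-from : ∀ {a b c} → 0ℤ ≤ c → c ≡ b - a → a ≤ b
  ≤-from 0≤c eq = ℤ.0≤i-j⇒j≤i (subst (_≤_ 0ℤ) eq 0≤c)

  diff : ∀ {a b} → a ≤ b → 0ℤ ≤ b - a
  diff = ℤ.i≤j⇒0≤j-i

  nonNeg-cancel : ∀ k {a} → 0ℤ < k → 0ℤ ≤ k * a → 0ℤ ≤ a
  nonNeg-cancel k {a} 0<k 0≤ka = ℤ.*-cancelˡ-≤-pos 0ℤ a k {{positive 0<k}} (subst (_≤ k * a) (sym (ℤ.*-zeroʳ k)) 0≤ka)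

  1≰0 : ¬ (1ℤ ≤ 0ℤ)
  1≰0 (+≤+ ())

  eq : ℕ → ℕ → ℤ
  eq x y with x ℕ.≟ y
  ... | yes _ = 1ℤ
  ... | no  _ = 0ℤ

  eq-refl : ∀ x → eq x x ≡ 1ℤ
  eq-refl x with x ℕ.≟ x
  ... | yes _   = refl
  ... | no  x≢x = contradiction refl x≢x

  eq-≡ : ∀ {x y} → x ≡ y → eq x y ≡ 1ℤ
  eq-≡ {x} refl = eq-refl x

  eq-≢ : ∀ {x y} → x ≢ y → eq x y ≡ 0ℤ
  eq-≢ {x} {y} x≢y with x ℕ.≟ y
  ... | yes x≡y = contradiction x≡y x≢y
  ... | no  _   = refl

  0≤eq : ∀ x y → 0ℤ ≤ eq x y
  0≤eq x y with x ℕ.≟ y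
  ... | yes _ = nat 1
  ... | no  _ = nat 0

  # : ℕ → List ℕ → ℤ
  # x xs = lsum (eq x) xs

  lsum-cong : ∀ {f g} xs → (∀ {x} → x ∈ xs → f x ≡ g x) → lsum f xs ≡ lsum g xs
  lsum-cong []       f≡g = refl
  lsum-cong (x ∷ xs) f≡g = cong₂ _+_ (f≡g (here refl)) (lsum-cong xs (f≡g ∘ there))

  lsum-nonNeg : ∀ {f} xs → (∀ {x} → x ∈ xs → 0ℤ ≤ f x) → 0ℤ ≤ lsum f xs
  lsum-nonNeg []       0≤f = nat 0
  lsum-nonNeg (x ∷ xs) 0≤f = nonNeg-+ (0≤f (here refl)) (lsum-nonNeg xs (0≤f ∘ there))

  lsum-≥ : ∀ {f} xs → (∀ {x} → x ∈ xs → 0ℤ ≤ f x) → ∀ {y} → y ∈ xs → f y ≤ lsum f xs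
  lsum-≥ {f} (x ∷ xs) 0≤f (here refl) = subst (_≤ f x + lsum f xs) (ℤ.+-identityʳ (f x)) (ℤ.+-monoʳ-≤ (f x)
        (lsum-nonNeg xs (0≤f ∘ there)))
  lsum-≥ {f} (x ∷ xs) 0≤f {y} (there y∈) = subst (_≤ f x + lsum f xs) (ℤ.+-identityˡ (f y)) (ℤ.+-mono-≤ (0≤f
        (here refl)) (lsum-≥ xs (0≤f ∘ there) y∈))

  lsum-linear : ∀ a b f g xs → lsum (λ x → a * f x + b * g x) xs ≡ a * lsum f xs + b * lsum g xs
  lsum-linear a b f g []       = lemma a b
    where
    lemma : ∀ a b → 0ℤ ≡ a * 0ℤ + b * 0ℤ
    lemma = solve-∀
  lsum-linear a b f g (x ∷ xs) = trans (cong (_+_ (a * f x + b * g x)) (lsum-linear a b f g xs)) (lemma a b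
        (f x) (g x) (lsum f xs) (lsum g xs))
    where
    lemma : ∀ a b fx gx s t → a * fx + b * gx + (a * s + b * t) ≡ a * (fx + s) + b * (gx + t)
    lemma = solve-∀

  0≤# : ∀ x xs → 0ℤ ≤ # x xs
  0≤# x xs = lsum-nonNeg xs (λ {y} _ → 0≤eq x y)

  #-∈ : ∀ x xs → 1ℤ ≤ # x xs → x ∈ xs
  #-∈ x []       1≤ = ⊥-elim (1≰0 1≤)
  #-∈ x (y ∷ ys) 1≤ with x ℕ.≟ y
  ... | yes x≡y = here x≡y
  ... | no  _   = there (#-∈ x ys (subst (_≤_ 1ℤ) (ℤ.+-identityˡ _) 1≤))

  #-∉ : ∀ x xs → ¬ (x ∈ xs) → # x xs ≡ 0ℤ
  #-∉ x []       x∉ = refl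
  #-∉ x (y ∷ ys) x∉ = cong₂ _+_ (eq-≢ (x∉ ∘ here)) (#-∉ x ys (x∉ ∘ there))

  one : ℕ → ℤ
  one _ = 1ℤ

  -- Residues modulo p and their negatives.

  module Modular (p : ℕ) (p-prime : Prime p) (7≤p : 7 ℕ.≤ p) where

    P Q : ℤ
    P = + p
    Q = + (p ℕ.* p)

    Q≡PP : Q ≡ P * P
    Q≡PP = ℤ.pos-* p p

    instance
      p≢0 : ℕ.NonZero p
      p≢0 = prime⇒nonZero p-prime

    0≤P-7 : 0ℤ ≤ P - + 7
    0≤P-7 = diff (+≤+ 7≤p)

    0<P : 0ℤ < P
    0<P = +<+ (ℕ.≤-trans (ℕ.s≤s ℕ.z≤n) 7≤p)

    Div : ℤ → Set
    Div z = P ∣ᶻ z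

    ∤small : ∀ {x} → 0 ℕ.< x → x ℕ.< p → ¬ Div (+ x)
    ∤small {suc x} _ x<p p∣x = ℕ.<⇒≱ x<p (∣⇒≤ (∣⇒∣ᵤ p∣x))

    -- Since p ≥ 7, the numbers 1 to 6 are units modulo p. Eliminating between linear relations of
    -- symbols only produces such coefficients.
    Div-cancel : ∀ k {z} → 0 ℕ.< k → k ℕ.< 7 → Div (+ k * z) → Div z
    Div-cancel k {z} 0<k k<7 p∣kz with euclidsLemma k ∣ z ∣ p-prime (subst (p ∣_) (ℤ.abs-* (+ k) z) (∣⇒∣ᵤ p∣kz))
    ... | inj₁ p∣k = ⊥-elim (∤small 0<k (ℕ.≤-trans k<7 7≤p) (∣ᵤ⇒∣ p∣k))
    ... | inj₂ p∣z = ∣ᵤ⇒∣ p∣z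

    Div-≡ : ∀ {x y} → x ℕ.< p → y ℕ.< p → Div (+ x - + y) → x ≡ y
    Div-≡ {x} {y} x<p y<p p∣ with ℕ.<-cmp x y
    ... | tri≈ _ x≡y _ = x≡y
    ... | tri> _ _ y<x = ⊥-elim (∤small (ℕ.m<n⇒0<n∸m y<x) (ℕ.≤-<-trans (ℕ.m∸n≤m x y) x<p)
          (subst Div (trans (ℤ.m-n≡m⊖n x y) (ℤ.⊖-≥ (ℕ.<⇒≤ y<x))) p∣))
    ... | tri< x<y _ _ = ⊥-elim (∤small (ℕ.m<n⇒0<n∸m x<y) (ℕ.≤-<-trans (ℕ.m∸n≤m y x) y<p)
          (subst Div (trans (lemma (+ x) (+ y)) (trans (ℤ.m-n≡m⊖n y x) (ℤ.⊖-≥ (ℕ.<⇒≤ x<y)))) (∣m⇒∣-m p∣)))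
      where
      lemma : ∀ x y → - (x - y) ≡ y - x
      lemma = solve-∀

    sum-Div : ∀ {xs} → ZeroSum p xs → Div (lsum (+_) xs)
    sum-Div {xs} zs = subst Div (sym (lsum-id xs)) (∣ᵤ⇒∣ (ZeroSum.divides zs))

    neg : ℕ → ℕ
    neg x = p ℕ.∸ x

    +neg : ∀ {x} → x ℕ.< p → + neg x ≡ P - + x
    +neg {x} x<p = sym (trans (ℤ.m-n≡m⊖n p x) (ℤ.⊖-≥ (ℕ.<⇒≤ x<p)))

    neg-range : ∀ {x} → InRange p x → InRange p (neg x)
    neg-range (0<x , x<p) = ℕ.m<n⇒0<n∸m x<p , ℕ.∸-monoʳ-< 0<x (ℕ.<⇒≤ x<p)

    neg-neg : ∀ {x} → x ℕ.< p → neg (neg x) ≡ x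
    neg-neg x<p = ℕ.m∸[m∸n]≡n (ℕ.<⇒≤ x<p)

    neg-unique : ∀ {x y} → x ℕ.< p → InRange p y → Div (+ x + + y) → x ≡ neg y
    neg-unique {x} {y} x<p ry p∣ = Div-≡ x<p (proj₂ (neg-range ry))
      (subst Div (trans (lemma (+ x) (+ y) P) (cong (λ z → + x - z) (sym (+neg (proj₂ ry))))) (∣m∣n⇒∣m-n p∣ ∣-refl))
      where
      lemma : ∀ x y q → x + y - q ≡ x - (q - y)
      lemma = solve-∀

    neg-≢ : ∀ {x} → InRange p x → neg x ≢ x
    neg-≢ {x} (0<x , x<p) nx≡x = ∤small 0<x x<p (Div-cancel 2 {+ x} (ℕ.s≤s ℕ.z≤n) (ℕ.s≤s (ℕ.s≤s (ℕ.s≤s ℕ.z≤n)))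
      (subst Div (trans (lemma P (+ x)) (trans (cong (_+ + x) (trans (sym (+neg x<p)) (cong +_ nx≡x))) (double
            (+ x)))) (∣-refl {P})))
      where
      lemma : ∀ q x → q ≡ q - x + x
      lemma = solve-∀
      double : ∀ x → x + x ≡ + 2 * x
      double = solve-∀

  -- Bounds for the weight and for the multiplicities of symbols.

  lsum-+ : ∀ f g xs → lsum (λ x → f x + g x) xs ≡ lsum f xs + lsum g xs
  lsum-+ f g []       = refl
  lsum-+ f g (x ∷ xs) = trans (cong (_+_ (f x + g x)) (lsum-+ f g xs)) (lemma (f x) (g x) (lsum f xs) (lsum g xs))
    where
    lemma : ∀ a b s t → a + b + (s + t) ≡ a + s + (b + t)
    lemma = solve-∀

  pos-sum : ∀ {f} xs → (∀ {x} → x ∈ xs → 0ℤ ≤ f x) → ∀ {y} → y ∈ xs → 0ℤ < f y → 0ℤ < lsum f xs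
  pos-sum xs 0≤f y∈ 0<fy = ℤ.<-≤-trans 0<fy (lsum-≥ xs 0≤f y∈)

  module _ (u k n P : ℤ) where
    private
      identity : ∀ u k n P → (P - u) * (k - u) + (u - 1ℤ) * (k * P - (P - 1ℤ) * n - u) ≡ (P - 1ℤ) * (u *
            (k - 1ℤ) - (u - 1ℤ) * n)
      identity = solve-∀
      small : ∀ u k n → (u - 1ℤ) * (k - (1ℤ + n)) + ((k - (1ℤ + n)) + n) ≡ u * (k - 1ℤ) - (u - 1ℤ) * n
      small = solve-∀
      impossible : ∀ u k n P → (k * P - (P - 1ℤ) * n - u) + (P - 1ℤ) * (n - k) + (u - (1ℤ + k)) ≡ 0ℤ - 1ℤ
      impossible = solve-∀

    -- In the application k P is the sum of P - y over the symbols y of a line through -u, and n is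
    -- its number of ones. For k ≥ u the claim is a combination of the gap and (P - u)(k - u). For k
    -- < u it comes from integrality: n ≥ k would make the gap negative, so n ≤ k - 1. The line with
    -- u ones and one -u has k = n = u and gives equality.
    multiplicity-bound : 0ℤ ≤ u - 1ℤ → 0ℤ ≤ P - u → 0ℤ < P - 1ℤ → 0ℤ ≤ n → 0ℤ ≤ k * P - (P - 1ℤ) * n - u →
      0ℤ ≤ u * (k - 1ℤ) - (u - 1ℤ) * n
    multiplicity-bound 1≤u u≤P 1<P 0≤n gap with ℤ.<-cmp k u
    ... | tri≈ _ k≡u _ = nonNeg-cancel (P - 1ℤ) 1<P (subst (_≤_ 0ℤ) (identity u k n P)
          (nonNeg-+ (nonNeg-* u≤P (diff (ℤ.≤-reflexive (sym k≡u)))) (nonNeg-* 1≤u gap)))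
    ... | tri> _ _ u<k = nonNeg-cancel (P - 1ℤ) 1<P (subst (_≤_ 0ℤ) (identity u k n P)
          (nonNeg-+ (nonNeg-* u≤P (diff (ℤ.<⇒≤ u<k))) (nonNeg-* 1≤u gap)))
    ... | tri< k<u _ _ with k ℤ.≤? n
    ...   | yes k≤n = ⊥-elim (1≰0 (ℤ.0≤i-j⇒j≤i (subst (_≤_ 0ℤ) (impossible u k n P)
            (nonNeg-+ (nonNeg-+ gap (nonNeg-* (ℤ.<⇒≤ 1<P) (diff k≤n))) (diff (ℤ.i<j⇒suc[i]≤j k<u))))))
    ...   | no  k≰n = subst (_≤_ 0ℤ) (small u k n) (nonNeg-+ (nonNeg-* 1≤u n<k) (nonNeg-+ n<k 0≤n))
      where
      n<k : 0ℤ ≤ k - (1ℤ + n)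
      n<k = diff (ℤ.i<j⇒suc[i]≤j (ℤ.≰⇒> k≰n))

  least-≥2 : ∀ xs y → y ∈ xs → 2 ℕ.≤ y →
    ∃[ u ] (u ∈ xs × 2 ℕ.≤ u × u ℕ.≤ y × (∀ {z} → z ∈ xs → 2 ℕ.≤ z → u ℕ.≤ z))
  least-≥2 xs = <-rec _ step
    where
    step : ∀ y → (∀ {z} → z ℕ.< y → z ∈ xs → 2 ℕ.≤ z → _) → y ∈ xs → 2 ℕ.≤ y →
      ∃[ u ] (u ∈ xs × 2 ℕ.≤ u × u ℕ.≤ y × (∀ {z} → z ∈ xs → 2 ℕ.≤ z → u ℕ.≤ z))
    step y rec y∈ 2≤y with Any.any? (λ z → (2 ℕ.≤? z) ×-dec (z ℕ.<? y)) xs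
    ... | no none = y , y∈ , 2≤y , ℕ.≤-refl , λ z∈ 2≤z → ℕ.≮⇒≥ (λ z<y → none (lose z∈ (2≤z , z<y)))
    ... | yes some with find some
    ...   | z , z∈ , 2≤z , z<y with rec z<y z∈ 2≤z
    ...     | u , u∈ , 2≤u , u≤z , least = u , u∈ , 2≤u , ℕ.≤-trans u≤z (ℕ.<⇒≤ z<y) , least

  -- Quantifying over `f` inside lets one splitting serve both the residue sum of a line and the
  -- functional that is bounded on it.
  split-ones : ∀ xs → ∃[ n ] ∃[ r ] ((∀ {y} → y ∈ r → y ∈ xs × y ≢ 1) ×
    (∀ f → lsum f xs ≡ + n * f 1 + lsum f r) × (1 ∈ xs → 1 ℕ.≤ n))
  split-ones [] = 0 , [] , (λ ()) , (λ f → refl) , λ ()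
  split-ones (x ∷ xs) with split-ones xs | x ℕ.≟ 1
  ... | n , r , sub , sums , pos | yes refl = suc n , r , (λ y∈ → there (proj₁ (sub y∈)) , proj₂ (sub y∈)) ,
        (λ f → trans (cong (_+_ (f 1)) (sums f)) (lemma (f 1) (+ n) (lsum f r))) , λ _ → ℕ.s≤s ℕ.z≤n
    where
    lemma : ∀ a n l → a + (n * a + l) ≡ (1ℤ + n) * a + l
    lemma = solve-∀
  ... | n , r , sub , sums , pos | no x≢1 = n , x ∷ r , sub′ ,
        (λ f → trans (cong (_+_ (f x)) (sums f)) (lemma (f x) (+ n * f 1) (lsum f r))) , pos′
    where
    lemma : ∀ a b c → a + (b + c) ≡ b + (a + c)
    lemma = solve-∀
    sub′ : ∀ {y} → y ∈ x ∷ r → y ∈ x ∷ xs × y ≢ 1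
    sub′ (here refl) = here refl , x≢1
    sub′ (there y∈)  = there (proj₁ (sub y∈)) , proj₂ (sub y∈)
    pos′ : 1 ∈ x ∷ xs → 1 ℕ.≤ n
    pos′ (here 1≡x)  = ⊥-elim (x≢1 (sym 1≡x))
    pos′ (there 1∈) = pos 1∈

  module Word (p : ℕ) (p-prime : Prime p) (7≤p : 7 ℕ.≤ p) (all : List ℕ)
    (range : ∀ {x} → x ∈ all → InRange p x) (pencil : Pencil p all)
    (light : lsum one all ≤ + 2 * + (p ℕ.* p) - + 2 * + p + + 4) where
    open Modular p p-prime 7≤p

    W : ℤ
    W = lsum one all

    slack : 0ℤ ≤ + 2 * Q - + 2 * P + + 4 - W
    slack = diff light

    Div-≥ : ∀ {z} → 0ℤ < z → Div z → P ≤ z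
    Div-≥ {+ suc n} _ d = +≤+ (∣⇒≤ (∣⇒∣ᵤ d))
    Div-≥ {+ zero} (+<+ ()) d

    -- A line through x meets the support in −x alone, or in at least two further points.
    opposite-bound : ∀ {x} → x ∈ all → + 2 * Q + + 3 - W ≤ # (neg x) all
    opposite-bound {x} x∈ = ≤-from (diff (pencil x∈ f (+ 3) bound)) (trans (cong₂ (λ s t → s + Q * t - + 3 *
          (1ℤ + Q)) (lsum-+ one (eq (neg x)) all)
        (cong (_+_ 1ℤ) (eq-≢ (neg-≢ (range x∈))))) (lemma W (# (neg x) all) Q))
      where
      f : ℕ → ℤ
      f y = one y + eq (neg x) y
      lemma : ∀ w s q → w + s + q * (1ℤ + 0ℤ) - + 3 * (1ℤ + q) ≡ s - (+ 2 * q + + 3 - w)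
      lemma = solve-∀
      e : ∀ y → 0ℤ ≤ eq (neg x) y
      e = 0≤eq (neg x)
      bound : ∀ xs → ZeroSum p xs → x ∈ xs → (∀ {y} → y ∈ xs → y ∈ all) → + 3 ≤ lsum f xs
      bound (y ∷ []) zs (here refl) _ =
        ⊥-elim (∤small (proj₁ (range x∈)) (proj₂ (range x∈)) (subst Div (ℤ.+-identityʳ (+ x)) (sum-Div zs)))
      bound (y ∷ z ∷ []) zs x∈xs _ with x∈xs
      ... | here refl = ≤-from (e x) (trans (lemma₁ (eq (neg x) x)) (cong (λ t → 1ℤ + eq (neg x) x +
            (1ℤ + t + 0ℤ) - + 3) (sym (eq-≡ (sym z≡)))))
        where
        lemma₁ : ∀ a → a ≡ 1ℤ + a + (1ℤ + 1ℤ + 0ℤ) - + 3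
        lemma₁ = solve-∀
        reorder : ∀ a b → a + (b + 0ℤ) ≡ b + a
        reorder = solve-∀
        z≡ : z ≡ neg x
        z≡ = neg-unique (proj₂ (ZeroSum.range zs (there (here refl)))) (range x∈) (subst Div (reorder (+ x)
              (+ z)) (sum-Div zs))
      ... | there (here refl) = ≤-from (e x) (trans (lemma₁ (eq (neg x) x)) (cong (λ t → 1ℤ + t + (1ℤ + eq
            (neg x) x + 0ℤ) - + 3) (sym (eq-≡ (sym y≡)))))
        where
        lemma₁ : ∀ a → a ≡ 1ℤ + 1ℤ + (1ℤ + a + 0ℤ) - + 3
        lemma₁ = solve-∀
        reorder : ∀ a b → a + (b + 0ℤ) ≡ a + b
        reorder = solve-∀
        y≡ : y ≡ neg x
        y≡ = neg-unique (proj₂ (ZeroSum.range zs (here refl))) (range x∈) (subst Div (reorder (+ y) (+ x)) (sum-Div zs))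
      bound (y ∷ z ∷ t ∷ r) zs x∈xs _ = ≤-from
        (nonNeg-+ (e y) (nonNeg-+ (e z) (nonNeg-+ (e t) (lsum-nonNeg {f} r (λ {w} _ → nonNeg-+ (nat 1) (e w))))))
        (lemma₁ (eq (neg x) y) (eq (neg x) z) (eq (neg x) t) (lsum f r))
        where
        lemma₁ : ∀ a b c d → a + (b + (c + d)) ≡ 1ℤ + a + (1ℤ + b + (1ℤ + c + d)) - + 3
        lemma₁ = solve-∀

    opposite-size : ∀ {x} → x ∈ all → + 2 * P - 1ℤ ≤ # (neg x) all
    opposite-size x∈ = ℤ.≤-trans (≤-from slack (lemma W P Q)) (opposite-bound x∈)
      where
      lemma : ∀ w p q → + 2 * q - + 2 * p + + 4 - w ≡ + 2 * q + + 3 - w - (+ 2 * p - 1ℤ)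
      lemma = solve-∀

    1≤2P-1 : 1ℤ ≤ + 2 * P - 1ℤ
    1≤2P-1 = ≤-from (nonNeg-+ (nonNeg-* (nat 2) 0≤P-7) (nat 12)) (lemma P)
      where
      lemma : ∀ p → + 2 * (p - + 7) + + 12 ≡ + 2 * p - 1ℤ - 1ℤ
      lemma = solve-∀

    neg∈all : ∀ {x} → x ∈ all → neg x ∈ all
    neg∈all x∈ = #-∈ _ all (ℤ.≤-trans 1≤2P-1 (opposite-size x∈))

    class-size : ∀ {x} → x ∈ all → + 2 * P - 1ℤ ≤ # x all
    class-size x∈ = subst (λ y → + 2 * P - 1ℤ ≤ # y all) (neg-neg (proj₂ (range x∈))) (opposite-size (neg∈all x∈))

    T : ℤ
    T = lsum (+_) all

    compl : ℕ → ℤ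
    compl y = P - + y

    lsum-compl : ∀ xs → lsum compl xs ≡ P * lsum one xs - lsum (+_) xs
    lsum-compl xs = trans (lsum-cong xs (λ {y} _ → lemma₁ P (+ y)))
      (trans (lsum-linear P (- 1ℤ) one +_ xs) (lemma₂ (P * lsum one xs) (lsum (+_) xs)))
      where
      lemma₁ : ∀ p y → p - y ≡ p * 1ℤ + - 1ℤ * y
      lemma₁ = solve-∀
      lemma₂ : ∀ a b → a + - 1ℤ * b ≡ a - b
      lemma₂ = solve-∀

    Div-compl : ∀ {xs} → ZeroSum p xs → Div (lsum compl xs)
    Div-compl {xs} zs = subst Div (sym (lsum-compl xs)) (∣m∣n⇒∣m-n (subst Div (ℤ.*-comm (lsum one xs) P)
          (∣n⇒∣m*n (lsum one xs) ∣-refl)) (sum-Div zs))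

    compl-pos : ∀ {x} → InRange p x → 0ℤ < compl x
    compl-pos r = subst (0ℤ <_) (+neg (proj₂ r)) (+<+ (proj₁ (neg-range r)))

    -- Symbols are read as the integers from 1 to p - 1. On a line through a point of symbol 1 their
    -- sum is positive and divisible by p, hence at least p.
    T-lower : 1 ∈ all → P * (1ℤ + Q) ≤ T + Q * 1ℤ
    T-lower 1∈ = pencil 1∈ +_ P (λ xs zs 1∈xs _ → Div-≥ (pos-sum xs (λ {y} _ → nat y) 1∈xs (+<+ (ℕ.s≤s ℕ.z≤n)))
          (sum-Div zs))

    range-1 : InRange p 1
    range-1 = ℕ.s≤s ℕ.z≤n , ℕ.≤-trans (ℕ.s≤s (ℕ.s≤s ℕ.z≤n)) 7≤p

    -- The argument of `T-lower` with p - y in place of y, at a point of symbol -1, where p - y is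
    -- 1.
    T-upper : 1 ∈ all → P * (1ℤ + Q) ≤ P * W - T + Q * 1ℤ
    T-upper 1∈ = subst₂ (λ s t → P * (1ℤ + Q) ≤ s + Q * t) (lsum-compl all)
      (trans (cong (_-_ P) (+neg (proj₂ range-1))) (lemma P))
      (pencil (neg∈all 1∈) compl P (λ xs zs x∈xs _ →
        Div-≥ (pos-sum xs (λ y∈ → ℤ.<⇒≤ (compl-pos (ZeroSum.range zs y∈))) x∈xs (compl-pos (neg-range range-1)))
              (Div-compl zs)))
      where
      lemma : ∀ p → p - (p - 1ℤ) ≡ 1ℤ
      lemma = solve-∀

    -- Adding `T-lower` and `T-upper` eliminates `T` and leaves p W ≥ 2 p (1 + q) - 2 q, which is
    -- divisible by p because q = p².
    weight-lower : 1 ∈ all → + 2 * Q - + 2 * P + + 2 ≤ W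
    weight-lower 1∈ = ℤ.0≤i-j⇒j≤i (nonNeg-cancel P 0<P (subst (_≤_ 0ℤ) eqn (nonNeg-+ (diff (T-lower 1∈)) (diff
          (T-upper 1∈)))))
      where
      lemma : ∀ p q t w → (t + q * 1ℤ - p * (1ℤ + q)) + (p * w - t + q * 1ℤ - p * (1ℤ + q)) ≡ p *
            (w - + 2 * q - + 2) + + 2 * q
      lemma = solve-∀
      lemma₂ : ∀ p q w → p * (w - + 2 * q - + 2) + + 2 * (p * p) ≡ p * (w - (+ 2 * q - + 2 * p + + 2))
      lemma₂ = solve-∀
      eqn : (T + Q * 1ℤ - P * (1ℤ + Q)) + (P * W - T + Q * 1ℤ - P * (1ℤ + Q)) ≡ P * (W - (+ 2 * Q - + 2 * P + + 2))
      eqn = trans (lemma P Q T W) (trans (cong (λ z → P * (W - + 2 * Q - + 2) + + 2 * z) Q≡PP) (lemma₂ P Q W))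

    Q-PP≡0 : Q - P * P ≡ 0ℤ
    Q-PP≡0 = ℤ.i≡j⇒i-j≡0 Q≡PP

    -- The ring solver treats p and q as independent variables, so its certificates carry a multiple
    -- of q - p², which is removed here.
    vanish : ∀ a c → a + (Q - P * P) * c ≡ a
    vanish a c = trans (cong (λ z → a + z * c) Q-PP≡0) (ℤ.+-identityʳ a)

    1<P : 0ℤ < P - 1ℤ
    1<P = ℤ.<-≤-trans (+<+ (ℕ.s≤s (ℕ.z≤n {5}))) (≤-from 0≤P-7 (lemma P))
      where
      lemma : ∀ p → p - + 7 ≡ p - 1ℤ - + 6
      lemma = solve-∀

    -- The lines through -u are tested with u (p - y), diminished by (u - 1) p at y = 1. By
    -- `multiplicity-bound` every such line yields at least u p, with equality on the line of u ones
    -- and one -u. The total contains -u T, which `T-lower` controls, and u p W, which the weight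
    -- bound controls.
    class-upper : ∀ {u} → 2 ℕ.≤ u → suc u ℕ.< p → 1 ∈ all → neg u ∈ all →
      (+ u - 1ℤ) * # 1 all ≤ + u * (P * (+ u - 1ℤ) + + 2)
    class-upper {u} 2≤u 1+u<p 1∈ -u∈ = ℤ.0≤i-j⇒j≤i (nonNeg-cancel P 0<P (subst (_≤_ 0ℤ) total
        (nonNeg-+ (nonNeg-+ (diff through) (nonNeg-* (nat u) (diff (T-lower 1∈)))) (nonNeg-* (nonNeg-* (nat u)
              (ℤ.<⇒≤ 0<P)) slack))))
      where
      U : ℤ
      U = + u
      u<p : u ℕ.< p
      u<p = ℕ.<-trans (ℕ.n<1+n u) 1+u<p
      1≤U : 0ℤ ≤ U - 1ℤ
      1≤U = diff (+≤+ (ℕ.<⇒≤ 2≤u))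
      b : ℤ
      b = - ((U - 1ℤ) * P)
      f : ℕ → ℤ
      f y = U * compl y + b * eq 1 y
      1≢-u : 1 ≢ neg u
      1≢-u 1≡ = ℕ.<-irrefl (trans (cong suc (trans (sym (neg-neg u<p)) (cong neg (sym 1≡)))) (ℕ.suc-pred p)) 1+u<p
      compl-neg : compl (neg u) ≡ U
      compl-neg = trans (cong (_-_ P) (+neg u<p)) (lemma P U)
        where
        lemma : ∀ p u → p - (p - u) ≡ u
        lemma = solve-∀
      -- `h` is p - y except that it vanishes at y = 1. Its sum over a line is thus at least its
      -- value u at the point -u, and this is the gap that `multiplicity-bound` asks for.
      h : ℕ → ℤ
      h y = 1ℤ * compl y + - (P - 1ℤ) * eq 1 y
      h-neg : h (neg u) ≡ U
      h-neg = trans (cong₂ (λ s t → 1ℤ * s + - (P - 1ℤ) * t) compl-neg (eq-≢ 1≢-u)) (lemma P U)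
        where
        lemma : ∀ p u → 1ℤ * u + - (p - 1ℤ) * 0ℤ ≡ u
        lemma = solve-∀
      0≤h : ∀ {y} → InRange p y → 0ℤ ≤ h y
      0≤h {y} r with 1 ℕ.≟ y
      ... | yes refl = ℤ.≤-reflexive (lemma P)
        where
        lemma : ∀ p → 0ℤ ≡ 1ℤ * (p - 1ℤ) + - (p - 1ℤ) * 1ℤ
        lemma = solve-∀
      ... | no _ = subst (_≤_ 0ℤ) (lemma P (compl y)) (ℤ.<⇒≤ (compl-pos r))
        where
        lemma : ∀ p c → c ≡ 1ℤ * c + - (p - 1ℤ) * 0ℤ
        lemma = solve-∀
      bound : ∀ xs → ZeroSum p xs → neg u ∈ xs → (∀ {y} → y ∈ xs → y ∈ all) → U * P ≤ lsum f xs
      bound xs zs -u∈xs _ with Div-compl zs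
      ... | dividesᶻ k K≡kP = ≤-from
        (nonNeg-* (ℤ.<⇒≤ 0<P) (multiplicity-bound U k (# 1 xs) P 1≤U (diff (+≤+ (ℕ.<⇒≤ u<p))) 1<P (0≤# 1 xs) gap))
        (trans (lemma U k (# 1 xs) P) (cong (_- U * P) (sym (trans (lsum-linear U b compl (eq 1) xs) (cong
              (λ K → U * K + b * # 1 xs) K≡kP)))))
        where
        lemma : ∀ u k n p → p * (u * (k - 1ℤ) - (u - 1ℤ) * n) ≡ u * (k * p) + - ((u - 1ℤ) * p) * n - u * p
        lemma = solve-∀
        lemma₂ : ∀ K p n u → 1ℤ * K + - (p - 1ℤ) * n - u ≡ K - (p - 1ℤ) * n - u
        lemma₂ = solve-∀
        gap : 0ℤ ≤ k * P - (P - 1ℤ) * # 1 xs - U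
        gap = subst (_≤_ 0ℤ) (trans (cong (_- U) (lsum-linear 1ℤ (- (P - 1ℤ)) compl (eq 1) xs))
          (trans (lemma₂ (lsum compl xs) P (# 1 xs) U) (cong (λ K → K - (P - 1ℤ) * # 1 xs - U) K≡kP)))
          (diff (subst (_≤ lsum h xs) h-neg (lsum-≥ xs (0≤h ∘ ZeroSum.range zs) -u∈xs)))
      f-neg : f (neg u) ≡ U * U
      f-neg = trans (cong₂ (λ s t → U * s + b * t) compl-neg (eq-≢ 1≢-u)) (trans (cong (_+_ (U * U))
            (ℤ.*-zeroʳ b)) (ℤ.+-identityʳ (U * U)))
      through : U * P * (1ℤ + Q) ≤ U * (P * W - T) + b * # 1 all + Q * (U * U)
      through = subst₂ (λ s t → U * P * (1ℤ + Q) ≤ s + Q * t)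
        (trans (lsum-linear U b compl (eq 1) all) (cong (λ K → U * K + b * # 1 all) (lsum-compl all))) f-neg
        (pencil -u∈ f (U * P) bound)
      lemma : ∀ u p q w t s →
        (u * (p * w - t) + - ((u - 1ℤ) * p) * s + q * (u * u) - u * p * (1ℤ + q)) + u * (t + q * 1ℤ - p * (1ℤ + q))
          + u * p * (+ 2 * q - + 2 * p + + 4 - w)
        ≡ p * (u * (p * (u - 1ℤ) + + 2) - (u - 1ℤ) * s) + (q - p * p) * (u * u + u)
      lemma = solve-∀
      total = trans (lemma U P Q W T (# 1 all)) (vanish _ _)

    -- The least symbol u ≥ 2 must be 2: lines almost entirely of symbol 1 carry at least u ones, and counting them
    -- through a point of symbol 1 forces more points of symbol 1 than class-upper allows when u ≥ 3.
    two∈all : 1 ∈ all → # (neg 1) all ≤ # 1 all → ∀ {y} → y ∈ all → y ≢ 1 → y ≢ neg 1 → 2 ∈ all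
    two∈all 1∈ s₋≤s {y} y∈ y≢1 y≢-1 with least-≥2 all y y∈ (ℕ.≤∧≢⇒< (proj₁ (range y∈)) (y≢1 ∘ sym))
    ... | u , u∈ , 2≤u , u≤y , least with 3 ℕ.≤? u
    ...   | no 3≰u = subst (_∈ all) (ℕ.≤-antisym (ℕ.s≤s⁻¹ (ℕ.≰⇒> 3≰u)) 2≤u) u∈
    ...   | yes 3≤u = ⊥-elim (ℤ.≤⇒≯ (subst (_≤_ 0ℤ) (contra v P W Q (# 1 all) (# (neg 1) all)) sumNonNeg) -<+)
      where
      U v : ℤ
      U = + u
      v = U - 1ℤ
      0≤v : 0ℤ ≤ v
      0≤v = diff (+≤+ (ℕ.<⇒≤ 2≤u))
      0≤v-2 : 0ℤ ≤ v - + 2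
      0≤v-2 = subst (_≤_ 0ℤ) (lemma U) (diff (+≤+ 3≤u))
        where
        lemma : ∀ u → u - + 3 ≡ u - 1ℤ - + 2
        lemma = solve-∀
      ru : InRange p u
      ru = range u∈
      2+y≤p : 2 ℕ.+ y ℕ.≤ p
      2+y≤p = ℕ.≤∧≢⇒< (proj₂ (range y∈)) (λ 1+y≡p → y≢-1 (trans (sym (ℕ.m+n∸m≡n 1 y)) (cong (ℕ._∸ 1) 1+y≡p)))
      2≤-u : 2 ℕ.≤ neg u
      2≤-u = subst (ℕ._≤ neg u) (ℕ.m+n∸n≡m 2 u) (ℕ.∸-monoˡ-≤ u (ℕ.≤-trans (ℕ.+-monoʳ-≤ 2 u≤y) 2+y≤p))
      -- -u occurs as well and is at least 2, so minimality gives u ≤ p - u. Lines consisting of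
      -- ones only then have at least 2 u points.
      u+u≤p : u ℕ.+ u ℕ.≤ p
      u+u≤p = subst (u ℕ.+ u ℕ.≤_) (ℕ.m+[n∸m]≡n (ℕ.<⇒≤ (proj₂ ru))) (ℕ.+-monoʳ-≤ u (least (neg∈all u∈) 2≤-u))
      1+u<p : suc u ℕ.< p
      1+u<p = ℕ.≤-trans (ℕ.+-monoˡ-≤ u 2≤u) u+u≤p
      g f : ℕ → ℤ
      g z = 1ℤ * (one z + eq (neg 1) z) + - 1ℤ * eq 1 z
      f z = 1ℤ * eq 1 z + v * g z
      f1 : f 1 ≡ 1ℤ
      f1 = trans (cong (λ t → 1ℤ * 1ℤ + v * (1ℤ * (1ℤ + t) + - 1ℤ * 1ℤ)) (eq-≢ (neg-≢ range-1))) (lemma v)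
        where
        lemma : ∀ v → 1ℤ * 1ℤ + v * (1ℤ * (1ℤ + 0ℤ) + - 1ℤ * 1ℤ) ≡ 1ℤ
        lemma = solve-∀
      f≢1 : ∀ {z} → z ≢ 1 → f z ≡ v + v * eq (neg 1) z
      f≢1 {z} z≢1 = trans (cong (λ t → 1ℤ * t + v * (1ℤ * (1ℤ + eq (neg 1) z) + - 1ℤ * t)) (eq-≢ (z≢1 ∘ sym)))
            (lemma v (eq (neg 1) z))
        where
        lemma : ∀ v e → 1ℤ * 0ℤ + v * (1ℤ * (1ℤ + e) + - 1ℤ * 0ℤ) ≡ v + v * e
        lemma = solve-∀
      v≤f : ∀ {z} → z ≢ 1 → 0ℤ ≤ f z - v
      v≤f {z} z≢1 = subst (_≤_ 0ℤ) (trans (lemma v (v * eq (neg 1) z)) (cong (_- v) (sym (f≢1 z≢1))))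
            (nonNeg-* 0≤v (0≤eq (neg 1) z))
        where
        lemma : ∀ v e → e ≡ v + e - v
        lemma = solve-∀
      bound : ∀ xs → ZeroSum p xs → 1 ∈ xs → (∀ {y} → y ∈ xs → y ∈ all) → 1ℤ + + 2 * v ≤ lsum f xs
      bound xs zs 1∈xs sub with split-ones xs
      ... | n , r , r⊆ , sums , pos = subst (1ℤ + + 2 * v ≤_) (sym (trans (sums f) (cong
            (λ t → + n * t + lsum f r) f1)))
            (go r r⊆ (subst Div (sums (+_)) (sum-Div zs)))
        where
        1≤n : 1 ℕ.≤ n
        1≤n = pos 1∈xs
        go : ∀ r → (∀ {y} → y ∈ r → y ∈ xs × y ≢ 1) → Div (+ n * 1ℤ + lsum (+_) r) → 1ℤ + + 2 * v ≤ + n * 1ℤ + lsum f r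
        go [] _ d = ≤-from (nonNeg-+ (nonNeg-+ (diff n≥p) (diff (+≤+ u+u≤p))) (nat 1)) (lemma (+ n) P U)
          where
          n≥p : P ≤ + n
          n≥p = Div-≥ (+<+ 1≤n) (subst Div (trans (ℤ.+-identityʳ _) (ℤ.*-identityʳ (+ n))) d)
          lemma : ∀ n p u → (n - p) + (p - (u + u)) + 1ℤ ≡ n * 1ℤ + 0ℤ - (1ℤ + + 2 * (u - 1ℤ))
          lemma = solve-∀
        go (z ∷ []) r⊆ d = single (neg 1 ℕ.≟ z)
          where
          z∈xs : z ∈ xs
          z∈xs = proj₁ (r⊆ (here refl))
          z≢1 : z ≢ 1
          z≢1 = proj₂ (r⊆ (here refl))
          lemma₁ : ∀ n v → n - 1ℤ ≡ n * 1ℤ + (v + v * 1ℤ + 0ℤ) - (1ℤ + + 2 * v)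
          lemma₁ = solve-∀
          lemma₂ : ∀ n u fz → (n - u) + (fz - (u - 1ℤ)) ≡ n * 1ℤ + (fz + 0ℤ) - (1ℤ + + 2 * (u - 1ℤ))
          lemma₂ = solve-∀
          reorder : ∀ n z → n * 1ℤ + (z + 0ℤ) ≡ z + n
          reorder = solve-∀
          single : Dec (neg 1 ≡ z) → 1ℤ + + 2 * v ≤ + n * 1ℤ + lsum f (z ∷ [])
          single (yes -1≡z) = ≤-from (diff (+≤+ 1≤n)) (trans (lemma₁ (+ n) v) (cong (λ t → + n * 1ℤ + (t + 0ℤ) -
                (1ℤ + + 2 * v))
            (sym (trans (f≢1 z≢1) (cong (λ e → v + v * e) (eq-≡ -1≡z))))))
          single (no -1≢z) = ≤-from (nonNeg-+ (diff (+≤+ u≤n)) (v≤f z≢1)) (lemma₂ (+ n) U (f z))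
            where
            -- If n < u, the single further point is z = -n, so n occurs too. As z ≠ -1, n is at
            -- least 2, against the minimality of u.
            u≤n : u ℕ.≤ n
            u≤n = ℕ.≮⇒≥ λ n<u →
              let rn : InRange p n
                  rn = 1≤n , ℕ.<-trans n<u (proj₂ ru)
                  z≡-n : z ≡ neg n
                  z≡-n = neg-unique (proj₂ (ZeroSum.range zs z∈xs)) rn (subst Div (reorder (+ n) (+ z)) d)
                  n∈all : n ∈ all
                  n∈all = subst (_∈ all) (neg-neg (proj₂ rn)) (neg∈all (subst (_∈ all) z≡-n (sub z∈xs)))
                  2≤n : 2 ℕ.≤ n
                  2≤n = ℕ.≤∧≢⇒< 1≤n (λ 1≡n → -1≢z (trans (cong neg 1≡n) (sym z≡-n)))
              in ℕ.<⇒≱ n<u (least n∈all 2≤n)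
        go (z ∷ z′ ∷ r) r⊆ d = ≤-from
          (nonNeg-+ (nonNeg-+ (diff (+≤+ 1≤n)) (v≤f (proj₂ (r⊆ (here refl)))))
            (nonNeg-+ (v≤f (proj₂ (r⊆ (there (here refl))))) (lsum-nonNeg {f} r (λ {w} w∈ →
              subst (_≤_ 0ℤ) (back (f w) v) (nonNeg-+ (v≤f (proj₂ (r⊆ (there (there w∈))))) 0≤v)))))
          (lemma (+ n) v (f z) (f z′) (lsum f r))
          where
          back : ∀ a v → a - v + v ≡ a
          back = solve-∀
          lemma : ∀ n v a b c → (n - 1ℤ) + (a - v) + ((b - v) + c) ≡ n * 1ℤ + (a + (b + c)) - (1ℤ + + 2 * v)
          lemma = solve-∀
      lsum-f : lsum f all ≡ 1ℤ * # 1 all + v * (1ℤ * (W + # (neg 1) all) + - 1ℤ * # 1 all)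
      lsum-f = trans (lsum-linear 1ℤ v (eq 1) g all) (cong (λ t → 1ℤ * # 1 all + v * t)
        (trans (lsum-linear 1ℤ (- 1ℤ) (λ z → one z + eq (neg 1) z) (eq 1) all)
          (cong (λ t → 1ℤ * t + - 1ℤ * # 1 all) (lsum-+ one (eq (neg 1)) all))))
      through : (1ℤ + + 2 * v) * (1ℤ + Q) ≤ 1ℤ * # 1 all + v * (1ℤ * (W + # (neg 1) all) + - 1ℤ * # 1 all) + Q * 1ℤ
      through = subst₂ (λ s t → (1ℤ + + 2 * v) * (1ℤ + Q) ≤ s + Q * t) lsum-f f1 (pencil 1∈ f (1ℤ + + 2 * v) bound)
      -- `through` gives s₁ ≥ 1 + v (2 p - 2), whereas `class-upper` gives v s₁ ≤ (v + 1)(p v + 2).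
      -- The last summands certify that the two are incompatible for v ≥ 2 and p ≥ 7.
      sumNonNeg = nonNeg-+ (nonNeg-+
        (nonNeg-* 0≤v (nonNeg-+ (diff through) (nonNeg-* 0≤v (nonNeg-+ slack (diff s₋≤s)))))
        (subst (λ w → 0ℤ ≤ w * (P * v + + 2) - v * # 1 all) (lemma U) (diff (class-upper 2≤u 1+u<p 1∈ (neg∈all u∈)))))
        (nonNeg-+ (nonNeg-+ (nonNeg-* (nonNeg-* 0≤v 0≤P-2) 0≤v-2) (nonNeg-* 0≤v 0≤P-7)) (nonNeg-* (nat 2) 0≤v-2))
        where
        lemma : ∀ u → u ≡ u - 1ℤ + 1ℤ
        lemma = solve-∀
        lemma₂ : ∀ p → p - + 7 + + 5 ≡ p - + 2
        lemma₂ = solve-∀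
        0≤P-2 : 0ℤ ≤ P - + 2
        0≤P-2 = subst (_≤_ 0ℤ) (lemma₂ P) (nonNeg-+ 0≤P-7 (nat 5))
      contra : ∀ v p w q s t →
        v * ((1ℤ * s + v * (1ℤ * (w + t) + - 1ℤ * s) + q * 1ℤ - (1ℤ + + 2 * v) * (1ℤ + q))
            + v * ((+ 2 * q - + 2 * p + + 4 - w) + (s - t)))
          + ((v + 1ℤ) * (p * v + + 2) - v * s)
          + (v * (p - + 2) * (v - + 2) + v * (p - + 7) + + 2 * (v - + 2))
        ≡ - + 2
      contra = solve-∀

  -- Scaling a word so that a given symbol becomes 1, and closure under doubling.

  lsum-map : ∀ f g xs → lsum f (map g xs) ≡ lsum (f ∘ g) xs
  lsum-map f g []       = refl
  lsum-map f g (x ∷ xs) = cong (_+_ (f (g x))) (lsum-map f g xs)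

  module Scaling (p : ℕ) (p-prime : Prime p) (7≤p : 7 ℕ.≤ p) where
    open Modular p p-prime 7≤p

    scale : ℕ → ℕ → ℕ
    scale k x = (k ℕ.* x) ℕ.% p

    Div-scale : ∀ k x → Div (+ scale k x - + k * + x)
    Div-scale k x = dividesᶻ (- (+ ((k ℕ.* x) ℕ./ p))) (trans (cong (λ z → + scale k x - z)
      (trans (sym (ℤ.pos-* k x)) (trans (cong +_ (m≡m%n+[m/n]*n (k ℕ.* x) p))
        (trans (ℤ.pos-+ (scale k x) _) (cong (_+_ (+ scale k x)) (ℤ.pos-* ((k ℕ.* x) ℕ./ p) p)))))) (lemma
              (+ scale k x) (+ ((k ℕ.* x) ℕ./ p)) P))
      where
      lemma : ∀ s q p → s - (s + q * p) ≡ - q * p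
      lemma = solve-∀

    Div-lsum : ∀ f g xs → (∀ x → Div (f x - g x)) → Div (lsum f xs - lsum g xs)
    Div-lsum f g []       d = dividesᶻ 0ℤ refl
    Div-lsum f g (x ∷ xs) d = subst Div (lemma (f x) (g x) (lsum f xs) (lsum g xs)) (∣m∣n⇒∣m+n (d x)
          (Div-lsum f g xs d))
      where
      lemma : ∀ a b s t → (a - b) + (s - t) ≡ a + s - (b + t)
      lemma = solve-∀

    Div-resp : ∀ {a b} → Div (a - b) → Div b → Div a
    Div-resp {a} {b} d e = subst Div (lemma a b) (∣m∣n⇒∣m+n d e)
      where
      lemma : ∀ a b → a - b + b ≡ a
      lemma = solve-∀

    inverse : ∀ {x} → InRange p x → ∃[ k ] Div (+ k * + x - 1ℤ)
    inverse {x@(suc _)} (_ , x<p) with coprime-Bézout (prime⇒coprime p-prime x<p)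
    -- Here 1 + b x = a p, so -b is the inverse of x; the factor p - 1 keeps it a natural number.
    ... | Bézout.Identity.+- a b e = b ℕ.* (p ℕ.∸ 1) , dividesᶻ (+ b * + x - + a)
          (trans (cong (λ z → z * + x - 1ℤ) (trans (ℤ.pos-* b (p ℕ.∸ 1)) (cong (_*_ (+ b)) (+neg (ℕ.≤-trans
                (ℕ.s≤s (ℕ.s≤s ℕ.z≤n)) 7≤p)))))
            (trans (lemma₁ (+ b) (+ x) P) (trans (cong (λ z → + b * + x * P - z) e′) (lemma₂ (+ b * + x) (+ a) P))))
      where
      e′ : 1ℤ + + b * + x ≡ + a * P
      e′ = trans (cong (_+_ 1ℤ) (sym (ℤ.pos-* b x))) (trans (cong +_ e) (ℤ.pos-* a p))
      lemma₁ : ∀ b x p → b * (p - 1ℤ) * x - 1ℤ ≡ b * x * p - (1ℤ + b * x)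
      lemma₁ = solve-∀
      lemma₂ : ∀ c a p → c * p - a * p ≡ (c - a) * p
      lemma₂ = solve-∀
    ... | Bézout.Identity.-+ a b e = b , dividesᶻ (+ a) (trans (cong (_- 1ℤ) (sym e′)) (lemma (+ a * P)))
      where
      e′ : 1ℤ + + a * P ≡ + b * + x
      e′ = trans (cong (_+_ 1ℤ) (sym (ℤ.pos-* a p))) (trans (cong +_ e) (ℤ.pos-* b x))
      lemma : ∀ c → 1ℤ + c - 1ℤ ≡ c
      lemma = solve-∀

    module By {k x : ℕ} (kx≡1 : Div (+ k * + x - 1ℤ)) where
      -- Division by x modulo p: the symbol c x becomes c.
      μ : ℕ → ℕ
      μ = scale k

      μ<p : ∀ y → μ y ℕ.< p
      μ<p y = m%n<n (k ℕ.* y) p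

      μ-to : ∀ {c y} → c ℕ.< p → Div (+ y - + c * + x) → μ y ≡ c
      μ-to {c} {y} c<p d = Div-≡ (μ<p y) c<p (subst Div (lemma (+ μ y) (+ k) (+ y) (+ c) (+ x))
        (∣m∣n⇒∣m+n (∣m∣n⇒∣m+n (Div-scale k y) (∣n⇒∣m*n (+ k) d)) (∣n⇒∣m*n (+ c) kx≡1)))
        where
        lemma : ∀ m k y c x → (m - k * y) + k * (y - c * x) + c * (k * x - 1ℤ) ≡ m - c
        lemma = solve-∀

      μ-from : ∀ {c y} → μ y ≡ c → Div (+ y - + c * + x)
      μ-from {c} {y} refl = subst Div (lemma (+ μ y) (+ k) (+ y) (+ x))
        (∣m∣n⇒∣m+n (∣m⇒∣-m (∣n⇒∣m*n (+ x) (Div-scale k y))) (∣m⇒∣-m (∣n⇒∣m*n (+ y) kx≡1)))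
        where
        lemma : ∀ m k y x → - (x * (m - k * y)) + - (y * (k * x - 1ℤ)) ≡ y - m * x
        lemma = solve-∀

      μ-range : ∀ {y} → InRange p y → InRange p (μ y)
      μ-range {y} (0<y , y<p) = ℕ.n≢0⇒n>0 (λ μy≡0 → ∤small 0<y y<p (subst Div (lemma (+ y) (+ x))
            (μ-from μy≡0))) , μ<p y
        where
        lemma : ∀ y x → y - 0ℤ * x ≡ y
        lemma = solve-∀

      eq-μ : ∀ {c z} → c ℕ.< p → z ℕ.< p → Div (+ z - + c * + x) → ∀ {y} → y ℕ.< p → eq c (μ y) ≡ eq z y
      eq-μ {c} {z} c<p z<p d {y} y<p with z ℕ.≟ y
      ... | yes refl = eq-≡ (sym (μ-to c<p d))
      ... | no z≢y   = eq-≢ (λ c≡μy → z≢y (Div-≡ z<p y<p (subst Div (lemma (+ z) (+ y) (+ c * + x)) (∣m∣n⇒∣m-n d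
            (μ-from (sym c≡μy))))))
        where
        lemma : ∀ z y w → z - w - (y - w) ≡ z - y
        lemma = solve-∀

      zeroSum-map : ∀ {xs} → ZeroSum p xs → ZeroSum p (map μ xs)
      zeroSum-map {xs} zs = record
        { range   = λ y∈ → let z , z∈ , y≡μz = ∈-map⁻ μ y∈ in subst (InRange p) (sym y≡μz) (μ-range (ZeroSum.range zs z∈))
        ; divides = ∣⇒∣ᵤ (subst Div (lsum-id (map μ xs)) (subst Div (sym (lsum-map (+_) μ xs))
            (Div-resp (Div-lsum (λ y → + μ y) (λ y → + k * + y) xs (Div-scale k))
              (subst Div (sym (trans (lsum-cong xs (λ {y} _ → lemma (+ k * + y))) (trans (lsum-linear (+ k) 0ℤ
                    (+_) one xs) (lemma₂ (+ k) (lsum (+_) xs) (lsum one xs)))))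
                (∣n⇒∣m*n (+ k) (sum-Div zs))))))
        }
        where
        lemma : ∀ a → a ≡ a + 0ℤ * 1ℤ
        lemma = solve-∀
        lemma₂ : ∀ k a b → k * a + 0ℤ * b ≡ k * a
        lemma₂ = solve-∀

      -- Scaling keeps zero-sum lists zero-sum, so a functional for the scaled word pulls back to
      -- `f ∘ μ` for the original one.
      pencil-map : ∀ {all} → Pencil p all → Pencil p (map μ all)
      pencil-map {all} pencil {x′} x′∈ f t bound with ∈-map⁻ μ x′∈
      ... | y , y∈ , refl = subst (λ s → t * + suc (p ℕ.* p) ≤ s + + (p ℕ.* p) * f (μ y)) (sym (lsum-map f μ all))
        (pencil y∈ (f ∘ μ) t (λ xs zs y∈xs sub → subst (t ≤_) (lsum-map f μ xs)
          (bound (map μ xs) (zeroSum-map zs) (∈-map⁺ μ y∈xs)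
            (λ w∈ → let z , z∈ , w≡μz = ∈-map⁻ μ w∈ in subst (_∈ map μ all) (sym w≡μz) (∈-map⁺ μ (sub z∈))))))

  module Symbols (p : ℕ) (p-prime : Prime p) (7≤p : 7 ℕ.≤ p) (all : List ℕ)
    (range : ∀ {x} → x ∈ all → InRange p x) (pencil : Pencil p all)
    (light : lsum one all ≤ + 2 * + (p ℕ.* p) - + 2 * + p + + 4)
    (third : ∀ x → ∃[ z ] (z ∈ all × z ≢ x × z ≢ p ℕ.∸ x)) where
    open Modular p p-prime 7≤p
    open Scaling p p-prime 7≤p
    open Word p p-prime 7≤p all range pencil light using (neg∈all; class-size; W)

    module Normalised {x : ℕ} (x∈ : x ∈ all) where
      open By {proj₁ (inverse (range x∈))} {x} (proj₂ (inverse (range x∈))) public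
      x<p = proj₂ (range x∈)

      range′ : ∀ {y} → y ∈ map μ all → InRange p y
      range′ y∈ = let z , z∈ , y≡μz = ∈-map⁻ μ y∈ in subst (InRange p) (sym y≡μz) (μ-range (range z∈))

      W′ : lsum one (map μ all) ≡ W
      W′ = lsum-map one μ all

      light′ : lsum one (map μ all) ≤ + 2 * Q - + 2 * P + + 4
      light′ = subst (_≤ + 2 * Q - + 2 * P + + 4) (sym W′) light

      open Word p p-prime 7≤p (map μ all) range′ (pencil-map pencil) light′ public
        using (weight-lower; range-1; class-upper; two∈all)

      Div-1 : Div (+ x - 1ℤ * + x)
      Div-1 = subst Div (lemma (+ x)) (dividesᶻ 0ℤ refl)
        where
        lemma : ∀ x → 0ℤ ≡ x - 1ℤ * x
        lemma = solve-∀

      Div-neg : ∀ {c y} → c ℕ.< p → Div (+ y + + c * + x) → Div (+ y - + neg c * + x)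
      Div-neg {c} {y} c<p d = subst Div (trans (lemma (+ y) (+ c) (+ x) P) (cong (λ z → + y - z * + x) (sym
            (+neg c<p))))
        (∣m∣n⇒∣m-n d (∣n⇒∣m*n (+ x) (∣-refl {P})))
        where
        lemma : ∀ y c x p → y + c * x - x * p ≡ y - (p - c) * x
        lemma = solve-∀

      Div-neg1 : Div (+ neg x - + neg 1 * + x)
      Div-neg1 = Div-neg (proj₂ range-1) (subst Div (trans (lemma P (+ x)) (cong (_+ 1ℤ * + x) (sym
            (+neg x<p)))) (∣-refl {P}))
        where
        lemma : ∀ p x → p ≡ p - x + 1ℤ * x
        lemma = solve-∀

      1∈ : 1 ∈ map μ all
      1∈ = subst (_∈ map μ all) (μ-to (proj₂ range-1) Div-1) (∈-map⁺ μ x∈)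

      #-μ : ∀ {c z} → c ℕ.< p → z ℕ.< p → Div (+ z - + c * + x) → # c (map μ all) ≡ # z all
      #-μ c<p z<p d = trans (lsum-map _ μ all) (lsum-cong all (λ y∈ → eq-μ c<p z<p d (proj₂ (range y∈))))

      #1 : # 1 (map μ all) ≡ # x all
      #1 = #-μ (proj₂ range-1) x<p Div-1

      -1<p = proj₂ (neg-range range-1)
      -x<p = proj₂ (neg-range (range x∈))

      double′ : # (neg x) all ≤ # x all → ∃[ y ] (y ∈ all × Div (+ y - + 2 * + x))
      double′ smaller = let z , z∈ , z≢x , z≢-x = third x
                            2∈ = two∈all 1∈ (subst₂ _≤_ (sym (#-μ -1<p -x<p Div-neg1)) (sym #1) smaller) (∈-map⁺ μ z∈)
                              (λ μz≡1 → z≢x (Div-≡ (proj₂ (range z∈)) x<p (subst Div (lemma₁ (+ z) (+ x))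
                                    (μ-from μz≡1))))
                              (λ μz≡-1 → z≢-x (Div-≡ (proj₂ (range z∈)) -x<p
                                (subst Div (lemma₂ (+ z) (+ neg x) (+ neg 1 * + x)) (∣m∣n⇒∣m-n
                                      (μ-from μz≡-1) Div-neg1))))
                            y , y∈ , 2≡μy = ∈-map⁻ μ 2∈
                        in y , y∈ , μ-from (sym 2≡μy)
        where
        lemma₁ : ∀ z x → z - 1ℤ * x ≡ z - x
        lemma₁ = solve-∀
        lemma₂ : ∀ z y w → z - w - (y - w) ≡ z - y
        lemma₂ = solve-∀

      -- After scaling, y is the symbol -2, and the case u = 2 of the general bound reads s₁ ≤ 2 (p
      -- + 2).
      upper : ∀ {y} → y ∈ all → Div (+ y + + 2 * + x) → # x all ≤ + 2 * P + + 4
      upper {y} y∈ d = subst₂ _≤_ (trans (ℤ.*-identityˡ _) #1) (lemma P)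
        (class-upper {2} (ℕ.s≤s (ℕ.s≤s ℕ.z≤n)) (ℕ.≤-trans (ℕ.s≤s (ℕ.s≤s (ℕ.s≤s (ℕ.s≤s ℕ.z≤n)))) 7≤p) 1∈
          (subst (_∈ map μ all) (μ-to (proj₂ (neg-range range-2)) (Div-neg (proj₂ range-2) d)) (∈-map⁺ μ y∈)))
        where
        range-2 : InRange p 2
        range-2 = ℕ.s≤s ℕ.z≤n , ℕ.≤-trans (ℕ.s≤s (ℕ.s≤s (ℕ.s≤s ℕ.z≤n))) 7≤p
        lemma : ∀ p → + 2 * (p * (+ 2 - 1ℤ) + + 2) ≡ + 2 * p + + 4
        lemma = solve-∀

    weight-lower : ∀ {x} → x ∈ all → + 2 * Q - + 2 * P + + 2 ≤ W
    weight-lower x∈ = subst (+ 2 * Q - + 2 * P + + 2 ≤_) W′ (N.weight-lower 1∈)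
      where
      module N = Normalised x∈
      open N

    -- The search for 2 needs s₋₁ ≤ s₁, so whichever of x and -x is at least as frequent is scaled
    -- to 1. One case yields 2 x, to be negated, the other 2 (-x) directly.
    double : ∀ {x} → x ∈ all → ∃[ y ] (y ∈ all × Div (+ y + + 2 * + x))
    double {x} x∈ with ℤ.≤-total (# (neg x) all) (# x all)
    ... | inj₁ smaller = let y , y∈ , d = Normalised.double′ x∈ smaller in neg y , neg∈all y∈ ,
          subst Div (trans (lemma P (+ y) (+ x)) (cong (_+ + 2 * + x) (sym (+neg (proj₂ (range y∈))))))
                (∣m∣n⇒∣m-n (∣-refl {P}) d)
      where
      lemma : ∀ p y x → p - (y - + 2 * x) ≡ p - y + + 2 * x
      lemma = solve-∀
    ... | inj₂ larger = let y , y∈ , d = Normalised.double′ (neg∈all x∈) (subst (λ z → # z all ≤ # (neg x) all) (sym (neg-neg (proj₂ (range x∈)))) larger)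
                        in y , y∈ , subst Div (trans (cong (λ z → + y - + 2 * z + + 2 * P) (+neg (proj₂ (range x∈)))) (lemma P (+ y) (+ x)))
                             (∣m∣n⇒∣m+n d (∣n⇒∣m*n (+ 2) (∣-refl {P})))
      where
      lemma : ∀ p y x → y - + 2 * (p - x) + + 2 * p ≡ y + + 2 * x
      lemma = solve-∀

    class-upper : ∀ {x} → x ∈ all → # x all ≤ + 2 * P + + 4
    class-upper x∈ = let y , y∈ , d = double x∈ in Normalised.upper x∈ y∈ d

  -- Sums over the non-zero residues, and the occurrence of every symbol.

  module Residues (p : ℕ) .{{_ : ℕ.NonZero p}} where

    R : (ℕ → ℤ) → ℤ
    R g = sum {p ℕ.∸ 1} (λ i → g (suc (toℕ i)))

    index-range : ∀ (i : Fin (p ℕ.∸ 1)) → InRange p (suc (toℕ i))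
    index-range i = ℕ.s≤s ℕ.z≤n , subst (suc (suc (toℕ i)) ℕ.≤_) (ℕ.suc-pred p) (ℕ.s≤s (Fin.toℕ<n i))

    R-cong : ∀ g h → (∀ {x} → InRange p x → g x ≡ h x) → R g ≡ R h
    R-cong g h g≡h = sum-cong-≗ {p ℕ.∸ 1} (λ i → g≡h (index-range i))

    R-mono : ∀ g h → (∀ {x} → InRange p x → g x ≤ h x) → R g ≤ R h
    R-mono g h g≤h = sum-mono {p ℕ.∸ 1} _ _ (λ i → g≤h (index-range i))

    R-+ : ∀ g h → R (λ x → g x + h x) ≡ R g + R h
    R-+ g h = ∑-distrib-+ {p ℕ.∸ 1} (λ i → g (suc (toℕ i))) (λ i → h (suc (toℕ i)))

    R-* : ∀ c g → R (λ x → c * g x) ≡ c * R g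
    R-* c g = sym (*-distribˡ-sum {p ℕ.∸ 1} c (λ i → g (suc (toℕ i))))

    R-const : ∀ c → R (λ _ → c) ≡ (+ p - 1ℤ) * c
    R-const c = trans (sum-const (p ℕ.∸ 1) c) (cong (_* c)
      (sym (trans (ℤ.m-n≡m⊖n p 1) (ℤ.⊖-≥ (ℕ.n≢0⇒n>0 (ℕ.≢-nonZero⁻¹ p))))))

    R-eq : ∀ {x} → InRange p x → ∀ (g : ℕ → ℤ) → R (λ y → eq y x * g y) ≡ g x
    R-eq {suc x} (_ , 1+x<p) g = trans (sum-single (λ j → eq (suc (toℕ j)) (suc x) * g (suc (toℕ j))) i off)
          (trans (cong₂ _*_ (eq-≡ toℕ-i) (cong g toℕ-i)) (ℤ.*-identityˡ (g (suc x))))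
      where
      x<p-1 : x ℕ.< p ℕ.∸ 1
      x<p-1 = ℕ.≤-pred (subst (suc (suc x) ℕ.≤_) (sym (ℕ.suc-pred p)) 1+x<p)
      i : Fin (p ℕ.∸ 1)
      i = fromℕ< x<p-1
      toℕ-i : suc (toℕ i) ≡ suc x
      toℕ-i = cong suc (Fin.toℕ-fromℕ< x<p-1)
      off : ∀ j → j ≢ i → eq (suc (toℕ j)) (suc x) * g (suc (toℕ j)) ≡ 0ℤ
      off j j≢i = cong (_* g (suc (toℕ j))) (eq-≢ (λ e → j≢i (Fin.toℕ-injective (ℕ.suc-injective (trans e
            (sym toℕ-i))))))

    lsum-R : ∀ g xs → (∀ {x} → x ∈ xs → InRange p x) → lsum g xs ≡ R (λ y → # y xs * g y)
    lsum-R g []       r = sym (sum-zero {p ℕ.∸ 1} (λ _ → 0ℤ) (λ i → refl))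
    lsum-R g (x ∷ xs) r = trans (cong₂ _+_ (sym (R-eq (r (here refl)) g)) (lsum-R g xs (r ∘ there)))
      (trans (sym (R-+ (λ y → eq y x * g y) (λ y → # y xs * g y)))
        (R-cong _ (λ y → # y (x ∷ xs) * g y) (λ {y} _ → sym (ℤ.*-distribʳ-+ (g y) (eq y x) (# y xs)))))

  module Full (p : ℕ) (p-prime : Prime p) (7≤p : 7 ℕ.≤ p) (all : List ℕ)
    (range : ∀ {x} → x ∈ all → InRange p x) (pencil : Pencil p all)
    (light : lsum one all ≤ + 2 * + (p ℕ.* p) - + 2 * + p + + 4)
    (third : ∀ x → ∃[ z ] (z ∈ all × z ≢ x × z ≢ p ℕ.∸ x)) where
    open Modular p p-prime 7≤p
    open Residues p
    open Word p p-prime 7≤p all range pencil light using (neg∈all; W; vanish)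
    open Symbols p p-prime 7≤p all range pencil light third

    -- A missing x is missing together with -x. At most p - 3 symbols remain, each at most 2 p + 4
    -- times, and (p - 3)(2 p + 4) = 2 p² - 2 p - 12 is below the least possible weight.
    all-symbols : ∀ {x} → InRange p x → x ∈ all
    all-symbols {x} rx with x ∈? all
    ... | yes x∈ = x∈
    ... | no  x∉ = ⊥-elim (ℤ.≤⇒≯ (subst (_≤_ 0ℤ) (trans (contra P Q W) (vanish _ _)) (nonNeg-+ (diff
          (weight-lower (proj₁ (proj₂ (third x))))) (diff too-light))) -<+)
      where
      M : ℤ
      M = + 2 * P + + 4
      0≤M : 0ℤ ≤ M
      0≤M = nonNeg-+ (nonNeg-* (nat 2) (ℤ.<⇒≤ 0<P)) (nat 4)
      -x∉ : ¬ (neg x ∈ all)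
      -x∉ -x∈ = x∉ (subst (_∈ all) (neg-neg (proj₂ rx)) (neg∈all -x∈))
      bound : ∀ {y} → InRange p y → # y all * 1ℤ ≤ M + (eq y x * - M + eq y (neg x) * - M)
      bound {y} ry with y ℕ.≟ x | y ℕ.≟ neg x
      ... | yes refl | yes y≡-y = ⊥-elim (neg-≢ ry (sym y≡-y))
      ... | yes refl | no _     = ℤ.≤-reflexive (trans (cong (_* 1ℤ) (#-∉ y all x∉)) (lemma M))
        where
        lemma : ∀ m → 0ℤ ≡ m + (1ℤ * - m + 0ℤ * - m)
        lemma = solve-∀
      ... | no _ | yes refl     = ℤ.≤-reflexive (trans (cong (_* 1ℤ) (#-∉ y all -x∉)) (lemma M))
        where
        lemma : ∀ m → 0ℤ ≡ m + (0ℤ * - m + 1ℤ * - m)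
        lemma = solve-∀
      ... | no _ | no _         = subst₂ _≤_ (sym (ℤ.*-identityʳ (# y all))) (lemma M) (small (y ∈? all))
        where
        lemma : ∀ m → m ≡ m + (0ℤ * - m + 0ℤ * - m)
        lemma = solve-∀
        small : Dec (y ∈ all) → # y all ≤ M
        small (yes y∈) = class-upper y∈
        small (no  y∉) = subst (_≤ M) (sym (#-∉ y all y∉)) 0≤M
      too-light : W ≤ (P - 1ℤ) * M + (- M + - M)
      too-light = subst₂ _≤_ (sym (lsum-R one all range))
        (trans (R-+ (λ _ → M) (λ y → eq y x * - M + eq y (neg x) * - M)) (cong₂ _+_ (R-const M)
          (trans (R-+ (λ y → eq y x * - M) (λ y → eq y (neg x) * - M)) (cong₂ _+_ (R-eq rx (λ _ → - M)) (R-eq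
                (neg-range rx) (λ _ → - M))))))
        (R-mono (λ y → # y all * 1ℤ) (λ y → M + (eq y x * - M + eq y (neg x) * - M)) bound)
      contra : ∀ p q w → (w - (+ 2 * q - + 2 * p + + 2)) + ((p - 1ℤ) * (+ 2 * p + + 4) + (- (+ 2 * p + + 4) + -
            (+ 2 * p + + 4)) - w)
        ≡ - + 14 + (q - p * p) * - + 2
      contra = solve-∀

  -- The map x ↦ -2x on lines with four support points.

  module Doubling (p : ℕ) (p-prime : Prime p) (7≤p : 7 ℕ.≤ p) where
    open Modular p p-prime 7≤p
    open Scaling p p-prime 7≤p

    2<7 : 2 ℕ.< 7
    2<7 = ℕ.s≤s (ℕ.s≤s (ℕ.s≤s ℕ.z≤n))

    range-2 : InRange p 2
    range-2 = ℕ.s≤s ℕ.z≤n , ℕ.<-≤-trans 2<7 7≤p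

    -- The symbol −2x.
    τ : ℕ → ℕ
    τ = scale (neg 2)

    Div-τ : ∀ x → Div (+ τ x + + 2 * + x)
    Div-τ x = subst Div (trans (cong (λ z → + τ x - z * + x + + x * P) (+neg (proj₂ range-2))) (lemma (+ τ x) (+ x) P))
      (∣m∣n⇒∣m+n (Div-scale (neg 2) x) (∣n⇒∣m*n (+ x) (∣-refl {P})))
      where
      lemma : ∀ t x p → t - (p - + 2) * x + x * p ≡ t + + 2 * x
      lemma = solve-∀

    τ-Div : ∀ {x y} → τ x ≡ y → Div (+ y + + 2 * + x)
    τ-Div {x} refl = Div-τ x

    absurd : ∀ k {x} → 0 ℕ.< k → k ℕ.< 7 → InRange p x → Div (+ k * + x) → ⊥
    absurd k 0<k k<7 (0<x , x<p) d = ∤small 0<x x<p (Div-cancel k 0<k k<7 d)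

    0<2 : 0 ℕ.< 2
    0<2 = ℕ.s≤s ℕ.z≤n
    0<3 : 0 ℕ.< 3
    0<3 = ℕ.s≤s ℕ.z≤n
    3<7 : 3 ℕ.< 7
    3<7 = ℕ.s≤s (ℕ.s≤s (ℕ.s≤s (ℕ.s≤s ℕ.z≤n)))
    0<5 : 0 ℕ.< 5
    0<5 = ℕ.s≤s ℕ.z≤n
    5<7 : 5 ℕ.< 7
    5<7 = ℕ.s≤s (ℕ.s≤s (ℕ.s≤s (ℕ.s≤s (ℕ.s≤s (ℕ.s≤s ℕ.z≤n)))))

    τ-≢ : ∀ {x} → InRange p x → τ x ≢ x
    τ-≢ {x} rx τx≡x = absurd 3 0<3 3<7 rx (subst Div (lemma (+ x)) (τ-Div τx≡x))
      where
      lemma : ∀ x → x + + 2 * x ≡ + 3 * x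
      lemma = solve-∀

    comb : ∀ k₀ k₁ k₂ k₃ {r₀ r₁ r₂ r₃} → Div r₀ → Div r₁ → Div r₂ → Div r₃ →
      Div (k₀ * r₀ + k₁ * r₁ + k₂ * r₂ + k₃ * r₃)
    comb k₀ k₁ k₂ k₃ d₀ d₁ d₂ d₃ =
      ∣m∣n⇒∣m+n (∣m∣n⇒∣m+n (∣m∣n⇒∣m+n (∣n⇒∣m*n k₀ d₀) (∣n⇒∣m*n k₁ d₁)) (∣n⇒∣m*n k₂ d₂)) (∣n⇒∣m*n k₃ d₃)

    Source : ℕ → ℕ → ℕ → ℕ → Set
    Source a b c d = τ a ≡ b ⊎ τ a ≡ c ⊎ τ a ≡ d

    -- Three sources give three linear relations besides a + b + c + d = 0. For each of the 27
    -- choices of targets, the coefficients passed to `comb` eliminate all but one symbol and leave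
    -- 2, 3 or 5 times that symbol, which is not 0 modulo p.
    no-three-sources : ∀ {a b c d} → InRange p a → InRange p b → InRange p c → InRange p d → Div
          (+ a + + b + + c + + d) →
      Source a b c d → Source b a c d → Source c a b d → ⊥
    no-three-sources {a} {b} {c} {d} ra rb rc rd s (inj₁ x) (inj₁ y) (inj₁ z) = absurd 3 0<3 3<7 rb
      (subst Div (identity (+ a) (+ b) (+ c) (+ d)) (comb (+ 0) (- + 1) (+ 2) (+ 0) s (τ-Div x) (τ-Div y) (τ-Div z)))
      where
      identity : ∀ a b c d → + 0 * (a + b + c + d) + - + 1 * (b + + 2 * a) + + 2 * (a + + 2 * b) + + 0 *
            (a + + 2 * c) ≡ + 3 * b
      identity = solve-∀
    no-three-sources {a} {b} {c} {d} ra rb rc rd s (inj₁ x) (inj₁ y) (inj₂ (inj₁ z)) = absurd 3 0<3 3<7 rb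
      (subst Div (identity (+ a) (+ b) (+ c) (+ d)) (comb (+ 0) (- + 1) (+ 2) (+ 0) s (τ-Div x) (τ-Div y) (τ-Div z)))
      where
      identity : ∀ a b c d → + 0 * (a + b + c + d) + - + 1 * (b + + 2 * a) + + 2 * (a + + 2 * b) + + 0 *
            (b + + 2 * c) ≡ + 3 * b
      identity = solve-∀
    no-three-sources {a} {b} {c} {d} ra rb rc rd s (inj₁ x) (inj₁ y) (inj₂ (inj₂ z)) = absurd 3 0<3 3<7 rb
      (subst Div (identity (+ a) (+ b) (+ c) (+ d)) (comb (+ 0) (- + 1) (+ 2) (+ 0) s (τ-Div x) (τ-Div y) (τ-Div z)))
      where
      identity : ∀ a b c d → + 0 * (a + b + c + d) + - + 1 * (b + + 2 * a) + + 2 * (a + + 2 * b) + + 0 *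
            (d + + 2 * c) ≡ + 3 * b
      identity = solve-∀
    no-three-sources {a} {b} {c} {d} ra rb rc rd s (inj₁ x) (inj₂ (inj₁ y)) (inj₁ z) = absurd 3 0<3 3<7 rd
      (subst Div (identity (+ a) (+ b) (+ c) (+ d)) (comb (+ 3) (- + 1) (- + 1) (- + 1) s (τ-Div x) (τ-Div y)
            (τ-Div z)))
      where
      identity : ∀ a b c d → + 3 * (a + b + c + d) + - + 1 * (b + + 2 * a) + - + 1 * (c + + 2 * b) + - + 1 *
            (a + + 2 * c) ≡ + 3 * d
      identity = solve-∀
    no-three-sources {a} {b} {c} {d} ra rb rc rd s (inj₁ x) (inj₂ (inj₁ y)) (inj₂ (inj₁ z)) = absurd 3 0<3 3<7 rc
      (subst Div (identity (+ a) (+ b) (+ c) (+ d)) (comb (+ 0) (+ 0) (- + 1) (+ 2) s (τ-Div x) (τ-Div y) (τ-Div z)))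
      where
      identity : ∀ a b c d → + 0 * (a + b + c + d) + + 0 * (b + + 2 * a) + - + 1 * (c + + 2 * b) + + 2 *
            (b + + 2 * c) ≡ + 3 * c
      identity = solve-∀
    no-three-sources {a} {b} {c} {d} ra rb rc rd s (inj₁ x) (inj₂ (inj₁ y)) (inj₂ (inj₂ z)) = absurd 5 0<5 5<7 rb
      (subst Div (identity (+ a) (+ b) (+ c) (+ d)) (comb (+ 2) (- + 1) (+ 2) (- + 2) s (τ-Div x) (τ-Div y) (τ-Div z)))
      where
      identity : ∀ a b c d → + 2 * (a + b + c + d) + - + 1 * (b + + 2 * a) + + 2 * (c + + 2 * b) + - + 2 *
            (d + + 2 * c) ≡ + 5 * b
      identity = solve-∀
    no-three-sources {a} {b} {c} {d} ra rb rc rd s (inj₁ x) (inj₂ (inj₂ y)) (inj₁ z) = absurd 5 0<5 5<7 ra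
      (subst Div (identity (+ a) (+ b) (+ c) (+ d)) (comb (+ 2) (+ 2) (- + 2) (- + 1) s (τ-Div x) (τ-Div y) (τ-Div z)))
      where
      identity : ∀ a b c d → + 2 * (a + b + c + d) + + 2 * (b + + 2 * a) + - + 2 * (d + + 2 * b) + - + 1 *
            (a + + 2 * c) ≡ + 5 * a
      identity = solve-∀
    no-three-sources {a} {b} {c} {d} ra rb rc rd s (inj₁ x) (inj₂ (inj₂ y)) (inj₂ (inj₁ z)) = absurd 2 0<2 2<7 rd
      (subst Div (identity (+ a) (+ b) (+ c) (+ d)) (comb (+ 2) (- + 1) (+ 0) (- + 1) s (τ-Div x) (τ-Div y) (τ-Div z)))
      where
      identity : ∀ a b c d → + 2 * (a + b + c + d) + - + 1 * (b + + 2 * a) + + 0 * (d + + 2 * b) + - + 1 *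
            (b + + 2 * c) ≡ + 2 * d
      identity = solve-∀
    no-three-sources {a} {b} {c} {d} ra rb rc rd s (inj₁ x) (inj₂ (inj₂ y)) (inj₂ (inj₂ z)) = absurd 2 0<2 2<7 ra
      (subst Div (identity (+ a) (+ b) (+ c) (+ d)) (comb (+ 2) (+ 0) (- + 1) (- + 1) s (τ-Div x) (τ-Div y) (τ-Div z)))
      where
      identity : ∀ a b c d → + 2 * (a + b + c + d) + + 0 * (b + + 2 * a) + - + 1 * (d + + 2 * b) + - + 1 *
            (d + + 2 * c) ≡ + 2 * a
      identity = solve-∀
    no-three-sources {a} {b} {c} {d} ra rb rc rd s (inj₂ (inj₁ x)) (inj₁ y) (inj₁ z) = absurd 3 0<3 3<7 rc
      (subst Div (identity (+ a) (+ b) (+ c) (+ d)) (comb (+ 0) (- + 1) (+ 0) (+ 2) s (τ-Div x) (τ-Div y) (τ-Div z)))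
      where
      identity : ∀ a b c d → + 0 * (a + b + c + d) + - + 1 * (c + + 2 * a) + + 0 * (a + + 2 * b) + + 2 *
            (a + + 2 * c) ≡ + 3 * c
      identity = solve-∀
    no-three-sources {a} {b} {c} {d} ra rb rc rd s (inj₂ (inj₁ x)) (inj₁ y) (inj₂ (inj₁ z)) = absurd 3 0<3 3<7 rd
      (subst Div (identity (+ a) (+ b) (+ c) (+ d)) (comb (+ 3) (- + 1) (- + 1) (- + 1) s (τ-Div x) (τ-Div y)
            (τ-Div z)))
      where
      identity : ∀ a b c d → + 3 * (a + b + c + d) + - + 1 * (c + + 2 * a) + - + 1 * (a + + 2 * b) + - + 1 *
            (b + + 2 * c) ≡ + 3 * d
      identity = solve-∀
    no-three-sources {a} {b} {c} {d} ra rb rc rd s (inj₂ (inj₁ x)) (inj₁ y) (inj₂ (inj₂ z)) = absurd 5 0<5 5<7 ra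
      (subst Div (identity (+ a) (+ b) (+ c) (+ d)) (comb (+ 2) (+ 2) (- + 1) (- + 2) s (τ-Div x) (τ-Div y) (τ-Div z)))
      where
      identity : ∀ a b c d → + 2 * (a + b + c + d) + + 2 * (c + + 2 * a) + - + 1 * (a + + 2 * b) + - + 2 *
            (d + + 2 * c) ≡ + 5 * a
      identity = solve-∀
    no-three-sources {a} {b} {c} {d} ra rb rc rd s (inj₂ (inj₁ x)) (inj₂ (inj₁ y)) (inj₁ z) = absurd 3 0<3 3<7 rc
      (subst Div (identity (+ a) (+ b) (+ c) (+ d)) (comb (+ 0) (- + 1) (+ 0) (+ 2) s (τ-Div x) (τ-Div y) (τ-Div z)))
      where
      identity : ∀ a b c d → + 0 * (a + b + c + d) + - + 1 * (c + + 2 * a) + + 0 * (c + + 2 * b) + + 2 *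
            (a + + 2 * c) ≡ + 3 * c
      identity = solve-∀
    no-three-sources {a} {b} {c} {d} ra rb rc rd s (inj₂ (inj₁ x)) (inj₂ (inj₁ y)) (inj₂ (inj₁ z)) = absurd 3 0<3 3<7 rc
      (subst Div (identity (+ a) (+ b) (+ c) (+ d)) (comb (+ 0) (+ 0) (- + 1) (+ 2) s (τ-Div x) (τ-Div y) (τ-Div z)))
      where
      identity : ∀ a b c d → + 0 * (a + b + c + d) + + 0 * (c + + 2 * a) + - + 1 * (c + + 2 * b) + + 2 *
            (b + + 2 * c) ≡ + 3 * c
      identity = solve-∀
    no-three-sources {a} {b} {c} {d} ra rb rc rd s (inj₂ (inj₁ x)) (inj₂ (inj₁ y)) (inj₂ (inj₂ z)) = absurd 2 0<2 2<7 rd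
      (subst Div (identity (+ a) (+ b) (+ c) (+ d)) (comb (+ 2) (- + 1) (- + 1) (+ 0) s (τ-Div x) (τ-Div y) (τ-Div z)))
      where
      identity : ∀ a b c d → + 2 * (a + b + c + d) + - + 1 * (c + + 2 * a) + - + 1 * (c + + 2 * b) + + 0 *
            (d + + 2 * c) ≡ + 2 * d
      identity = solve-∀
    no-three-sources {a} {b} {c} {d} ra rb rc rd s (inj₂ (inj₁ x)) (inj₂ (inj₂ y)) (inj₁ z) = absurd 3 0<3 3<7 rc
      (subst Div (identity (+ a) (+ b) (+ c) (+ d)) (comb (+ 0) (- + 1) (+ 0) (+ 2) s (τ-Div x) (τ-Div y) (τ-Div z)))
      where
      identity : ∀ a b c d → + 0 * (a + b + c + d) + - + 1 * (c + + 2 * a) + + 0 * (d + + 2 * b) + + 2 *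
            (a + + 2 * c) ≡ + 3 * c
      identity = solve-∀
    no-three-sources {a} {b} {c} {d} ra rb rc rd s (inj₂ (inj₁ x)) (inj₂ (inj₂ y)) (inj₂ (inj₁ z)) = absurd 5 0<5 5<7 rc
      (subst Div (identity (+ a) (+ b) (+ c) (+ d)) (comb (+ 2) (- + 1) (- + 2) (+ 2) s (τ-Div x) (τ-Div y) (τ-Div z)))
      where
      identity : ∀ a b c d → + 2 * (a + b + c + d) + - + 1 * (c + + 2 * a) + - + 2 * (d + + 2 * b) + + 2 *
            (b + + 2 * c) ≡ + 5 * c
      identity = solve-∀
    no-three-sources {a} {b} {c} {d} ra rb rc rd s (inj₂ (inj₁ x)) (inj₂ (inj₂ y)) (inj₂ (inj₂ z)) = absurd 2 0<2 2<7 ra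
      (subst Div (identity (+ a) (+ b) (+ c) (+ d)) (comb (+ 2) (+ 0) (- + 1) (- + 1) s (τ-Div x) (τ-Div y) (τ-Div z)))
      where
      identity : ∀ a b c d → + 2 * (a + b + c + d) + + 0 * (c + + 2 * a) + - + 1 * (d + + 2 * b) + - + 1 *
            (d + + 2 * c) ≡ + 2 * a
      identity = solve-∀
    no-three-sources {a} {b} {c} {d} ra rb rc rd s (inj₂ (inj₂ x)) (inj₁ y) (inj₁ z) = absurd 2 0<2 2<7 rd
      (subst Div (identity (+ a) (+ b) (+ c) (+ d)) (comb (+ 2) (+ 0) (- + 1) (- + 1) s (τ-Div x) (τ-Div y) (τ-Div z)))
      where
      identity : ∀ a b c d → + 2 * (a + b + c + d) + + 0 * (d + + 2 * a) + - + 1 * (a + + 2 * b) + - + 1 *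
            (a + + 2 * c) ≡ + 2 * d
      identity = solve-∀
    no-three-sources {a} {b} {c} {d} ra rb rc rd s (inj₂ (inj₂ x)) (inj₁ y) (inj₂ (inj₁ z)) = absurd 5 0<5 5<7 rb
      (subst Div (identity (+ a) (+ b) (+ c) (+ d)) (comb (+ 2) (- + 2) (+ 2) (- + 1) s (τ-Div x) (τ-Div y) (τ-Div z)))
      where
      identity : ∀ a b c d → + 2 * (a + b + c + d) + - + 2 * (d + + 2 * a) + + 2 * (a + + 2 * b) + - + 1 *
            (b + + 2 * c) ≡ + 5 * b
      identity = solve-∀
    no-three-sources {a} {b} {c} {d} ra rb rc rd s (inj₂ (inj₂ x)) (inj₁ y) (inj₂ (inj₂ z)) = absurd 2 0<2 2<7 rb
      (subst Div (identity (+ a) (+ b) (+ c) (+ d)) (comb (+ 2) (- + 1) (+ 0) (- + 1) s (τ-Div x) (τ-Div y) (τ-Div z)))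
      where
      identity : ∀ a b c d → + 2 * (a + b + c + d) + - + 1 * (d + + 2 * a) + + 0 * (a + + 2 * b) + - + 1 *
            (d + + 2 * c) ≡ + 2 * b
      identity = solve-∀
    no-three-sources {a} {b} {c} {d} ra rb rc rd s (inj₂ (inj₂ x)) (inj₂ (inj₁ y)) (inj₁ z) = absurd 5 0<5 5<7 rc
      (subst Div (identity (+ a) (+ b) (+ c) (+ d)) (comb (+ 2) (- + 2) (- + 1) (+ 2) s (τ-Div x) (τ-Div y) (τ-Div z)))
      where
      identity : ∀ a b c d → + 2 * (a + b + c + d) + - + 2 * (d + + 2 * a) + - + 1 * (c + + 2 * b) + + 2 *
            (a + + 2 * c) ≡ + 5 * c
      identity = solve-∀
    no-three-sources {a} {b} {c} {d} ra rb rc rd s (inj₂ (inj₂ x)) (inj₂ (inj₁ y)) (inj₂ (inj₁ z)) = absurd 3 0<3 3<7 rc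
      (subst Div (identity (+ a) (+ b) (+ c) (+ d)) (comb (+ 0) (+ 0) (- + 1) (+ 2) s (τ-Div x) (τ-Div y) (τ-Div z)))
      where
      identity : ∀ a b c d → + 0 * (a + b + c + d) + + 0 * (d + + 2 * a) + - + 1 * (c + + 2 * b) + + 2 *
            (b + + 2 * c) ≡ + 3 * c
      identity = solve-∀
    no-three-sources {a} {b} {c} {d} ra rb rc rd s (inj₂ (inj₂ x)) (inj₂ (inj₁ y)) (inj₂ (inj₂ z)) = absurd 2 0<2 2<7 rb
      (subst Div (identity (+ a) (+ b) (+ c) (+ d)) (comb (+ 2) (- + 1) (+ 0) (- + 1) s (τ-Div x) (τ-Div y) (τ-Div z)))
      where
      identity : ∀ a b c d → + 2 * (a + b + c + d) + - + 1 * (d + + 2 * a) + + 0 * (c + + 2 * b) + - + 1 *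
            (d + + 2 * c) ≡ + 2 * b
      identity = solve-∀
    no-three-sources {a} {b} {c} {d} ra rb rc rd s (inj₂ (inj₂ x)) (inj₂ (inj₂ y)) (inj₁ z) = absurd 2 0<2 2<7 rc
      (subst Div (identity (+ a) (+ b) (+ c) (+ d)) (comb (+ 2) (- + 1) (- + 1) (+ 0) s (τ-Div x) (τ-Div y) (τ-Div z)))
      where
      identity : ∀ a b c d → + 2 * (a + b + c + d) + - + 1 * (d + + 2 * a) + - + 1 * (d + + 2 * b) + + 0 *
            (a + + 2 * c) ≡ + 2 * c
      identity = solve-∀
    no-three-sources {a} {b} {c} {d} ra rb rc rd s (inj₂ (inj₂ x)) (inj₂ (inj₂ y)) (inj₂ (inj₁ z)) = absurd 2 0<2 2<7 rc
      (subst Div (identity (+ a) (+ b) (+ c) (+ d)) (comb (+ 2) (- + 1) (- + 1) (+ 0) s (τ-Div x) (τ-Div y) (τ-Div z)))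
      where
      identity : ∀ a b c d → + 2 * (a + b + c + d) + - + 1 * (d + + 2 * a) + - + 1 * (d + + 2 * b) + + 0 *
            (b + + 2 * c) ≡ + 2 * c
      identity = solve-∀
    no-three-sources {a} {b} {c} {d} ra rb rc rd s (inj₂ (inj₂ x)) (inj₂ (inj₂ y)) (inj₂ (inj₂ z)) = absurd 2 0<2 2<7 rc
      (subst Div (identity (+ a) (+ b) (+ c) (+ d)) (comb (+ 2) (- + 1) (- + 1) (+ 0) s (τ-Div x) (τ-Div y) (τ-Div z)))
      where
      identity : ∀ a b c d → + 2 * (a + b + c + d) + - + 1 * (d + + 2 * a) + - + 1 * (d + + 2 * b) + + 0 *
            (d + + 2 * c) ≡ + 2 * c
      identity = solve-∀

  module Weights (p : ℕ) (p-prime : Prime p) (7≤p : 7 ℕ.≤ p) (ω : ℕ → ℤ) (α : ℤ) (0≤α : 0ℤ ≤ α)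
    (ω-lower : ∀ {x} → InRange p x → α ≤ ω x) (ω-upper : ∀ {x} → InRange p x → + 13 * ω x ≤ + 18 * α) where
    open Modular p p-prime 7≤p
    open Doubling p p-prime 7≤p

    0≤ω : ∀ {x} → InRange p x → 0ℤ ≤ ω x
    0≤ω r = ℤ.≤-trans 0≤α (ω-lower r)

    e : ℕ → ℕ → ℤ
    e x y = eq (τ x) y - eq x y

    V : ℕ → ℕ → ℕ → ℕ → ℤ
    V x y z w = ω x * (+ 31 - + 52 * (e x y + e x z + e x w))

    eq≤1 : ∀ x y → eq x y ≤ 1ℤ
    eq≤1 x y with x ℕ.≟ y
    ... | yes _ = ℤ.≤-refl
    ... | no  _ = +≤+ ℕ.z≤n

    e≤1 : ∀ x y → e x y ≤ 1ℤ
    e≤1 x y = ≤-from (nonNeg-+ (diff (eq≤1 (τ x) y)) (0≤eq x y)) (lemma (eq (τ x) y) (eq x y))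
      where
      lemma : ∀ a b → (1ℤ - a) + b ≡ 1ℤ - (a - b)
      lemma = solve-∀

    e≤0 : ∀ {x y} → τ x ≢ y → e x y ≤ 0ℤ
    e≤0 {x} {y} τx≢y = ≤-from (0≤eq x y) (trans (lemma (eq x y)) (cong (λ a → 0ℤ - (a - eq x y)) (sym (eq-≢ τx≢y))))
      where
      lemma : ∀ b → b ≡ 0ℤ - (0ℤ - b)
      lemma = solve-∀

    e≡-1 : ∀ {x} → InRange p x → e x x ≤ - 1ℤ
    e≡-1 {x} r = ℤ.≤-reflexive (cong₂ _-_ (eq-≢ (τ-≢ r)) (eq-refl x))

    add₃ : ∀ {a b c k l m} → a ≤ k → b ≤ l → c ≤ m → a + b + c ≤ k + l + m
    add₃ a b c = ℤ.+-mono-≤ (ℤ.+-mono-≤ a b) c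

    module _ {x : ℕ} (r : InRange p x) {F : ℤ} where
      gap₁₃ : 0ℤ ≤ + 18 * α - + 13 * ω x
      gap₁₃ = diff (ω-upper r)

      13-cancel : ∀ {z} → 0ℤ ≤ + 13 * z → 0ℤ ≤ z
      13-cancel = nonNeg-cancel (+ 13) (+<+ (ℕ.s≤s ℕ.z≤n))

      V≥31 : F ≤ 0ℤ → + 31 * α ≤ ω x * (+ 31 - + 52 * F)
      V≥31 F≤ = ≤-from (nonNeg-+ (nonNeg-* (nat 31) (diff (ω-lower r))) (nonNeg-* (nonNeg-* (nat 52) (0≤ω r))
            (diff F≤))) (lemma α (ω x) F)
        where
        lemma : ∀ a w f → + 31 * (w - a) + + 52 * w * (0ℤ - f) ≡ w * (+ 31 - + 52 * f) - + 31 * a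
        lemma = solve-∀

      -- A point with one target has (31 - 52) ω ≥ -21 · 18/13 · α ≥ -31 α. It loses no more than a
      -- point without target gains.
      V≥-31 : F ≤ 1ℤ → - + 31 * α ≤ ω x * (+ 31 - + 52 * F)
      V≥-31 F≤ = ℤ.0≤i-j⇒j≤i (13-cancel (subst (_≤_ 0ℤ) (lemma α (ω x) F)
        (nonNeg-+ (nonNeg-+ (nonNeg-* (nat 21) gap₁₃) (nonNeg-* (nat 25) 0≤α)) (nonNeg-* (nonNeg-* (nat 676)
              (0≤ω r)) (diff F≤)))))
        where
        lemma : ∀ a w f → + 21 * (+ 18 * a - + 13 * w) + + 25 * a + + 676 * w * (1ℤ - f) ≡ + 13 * (w *
              (+ 31 - + 52 * f) - - + 31 * a)
        lemma = solve-∀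

      V≥-102 : F ≤ + 2 → - + 102 * α ≤ ω x * (+ 31 - + 52 * F)
      V≥-102 F≤ = ℤ.0≤i-j⇒j≤i (13-cancel (subst (_≤_ 0ℤ) (lemma α (ω x) F)
        (nonNeg-+ (nonNeg-+ (nonNeg-* (nat 73) gap₁₃) (nonNeg-* (nat 12) 0≤α)) (nonNeg-* (nonNeg-* (nat 676)
              (0≤ω r)) (diff F≤)))))
        where
        lemma : ∀ a w f → + 73 * (+ 18 * a - + 13 * w) + + 12 * a + + 676 * w * (+ 2 - f) ≡ + 13 * (w *
              (+ 31 - + 52 * f) - - + 102 * a)
        lemma = solve-∀

      V≥83 : F ≤ - 1ℤ → + 83 * α ≤ ω x * (+ 31 - + 52 * F)
      V≥83 F≤ = ≤-from (nonNeg-+ (nonNeg-* (nat 83) (diff (ω-lower r))) (nonNeg-* (nonNeg-* (nat 52) (0≤ω r))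
            (diff F≤))) (lemma α (ω x) F)
        where
        lemma : ∀ a w f → + 83 * (w - a) + + 52 * w * (- 1ℤ - f) ≡ w * (+ 31 - + 52 * f) - + 83 * a
        lemma = solve-∀

    total : ℕ → ℕ → ℕ → ℕ → ℤ
    total a b c d = V a b c d + V b a c d + V c a b d + V d a b c

    V-swap₁ : ∀ x y z w → V x y z w ≡ V x z y w
    V-swap₁ x y z w = cong (λ s → ω x * (+ 31 - + 52 * (s + e x w))) (ℤ.+-comm (e x y) (e x z))

    V-swap₂ : ∀ x y z w → V x y z w ≡ V x y w z
    V-swap₂ x y z w = cong (λ s → ω x * (+ 31 - + 52 * s)) (lemma (e x y) (e x z) (e x w))
      where
      lemma : ∀ a b c → a + b + c ≡ a + c + b
      lemma = solve-∀

    add₄ : ∀ {a b c d k l m n} → k ≤ a → l ≤ b → m ≤ c → n ≤ d → k + l + m + n ≤ a + b + c + d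
    add₄ a b c d = ℤ.+-mono-≤ (add₃ a b c) d

    total-swap₁ : ∀ a b c d → total a b c d ≡ total b a c d
    total-swap₁ a b c d = trans (cong₂ (λ s t → V a b c d + V b a c d + s + t) (V-swap₁ c a b d) (V-swap₁ d a b c))
      (cong (λ s → s + V c b a d + V d b a c) (ℤ.+-comm (V a b c d) (V b a c d)))

    total-swap₂ : ∀ a b c d → total a b c d ≡ total a c b d
    total-swap₂ a b c d = trans (cong₂ (λ s t → s + V b a c d + V c a b d + t) (V-swap₁ a b c d) (V-swap₂ d a b c))
      (lemma (V a c b d) (V b a c d) (V c a b d) (V d a c b))
      where
      lemma : ∀ a b c d → a + b + c + d ≡ a + c + b + d
      lemma = solve-∀

    total-swap₃ : ∀ a b c d → total a b c d ≡ total a b d c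
    total-swap₃ a b c d = trans (cong₂ (λ s t → s + t + V c a b d + V d a b c) (V-swap₂ a b c d) (V-swap₂ b a c d))
      (lemma (V a b d c) (V b a d c) (V c a b d) (V d a b c))
      where
      lemma : ∀ a b c d → a + b + c + d ≡ a + b + d + c
      lemma = solve-∀

    -- The line {a, −2a, −2a, 3a}.
    two-targets : ∀ {a b c d} → InRange p a → InRange p b → InRange p c → InRange p d → Div (+ a + + b + + c + + d) →
      τ a ≡ b → τ a ≡ c → 0ℤ ≤ total a b c d
    two-targets {a} {b} {.b} {d} ra rb _ rd s refl refl = ℤ.≤-trans (subst (_≤_ 0ℤ) (lemma α) (nonNeg-* (nat 33) 0≤α))
      (add₄ (V≥-102 ra (add₃ (e≤1 a b) (e≤1 a b) (e≤0 (a↛d ∘ τ-Div))))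
            (V≥83 rb (add₃ (e≤0 (b↛a ∘ τ-Div)) (e≡-1 rb) (e≤0 (b↛d ∘ τ-Div))))
            (V≥83 rb (add₃ (e≤0 (b↛a ∘ τ-Div)) (e≡-1 rb) (e≤0 (b↛d ∘ τ-Div))))
            -- For p = 7 the point d = 3a is a source as well, because -6a = a.
            (V≥-31 rd (add₃ (e≤1 d a) (e≤0 (d↛b ∘ τ-Div)) (e≤0 (d↛b ∘ τ-Div)))))
      where
      lemma : ∀ α → + 33 * α ≡ - + 102 * α + + 83 * α + + 83 * α + - + 31 * α
      lemma = solve-∀
      ab : Div (+ b + + 2 * + a)
      ab = Div-τ a
      a↛d : ¬ Div (+ d + + 2 * + a)
      a↛d ad = absurd 5 0<5 5<7 ra (subst Div (identity (+ a) (+ b) (+ d)) (comb (- 1ℤ) (+ 2) 1ℤ 0ℤ s ab ad s))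
        where
        identity : ∀ a b d → - 1ℤ * (a + b + b + d) + + 2 * (b + + 2 * a) + 1ℤ * (d + + 2 * a) + 0ℤ *
              (a + b + b + d) ≡ + 5 * a
        identity = solve-∀
      b↛a : ¬ Div (+ a + + 2 * + b)
      b↛a ba = absurd 3 0<3 3<7 ra (subst Div (identity (+ a) (+ b)) (∣m∣n⇒∣m-n (∣n⇒∣m*n (+ 2) ab) ba))
        where
        identity : ∀ a b → + 2 * (b + + 2 * a) - (a + + 2 * b) ≡ + 3 * a
        identity = solve-∀
      b↛d : ¬ Div (+ d + + 2 * + b)
      b↛d bd = ∤small (proj₁ ra) (proj₂ ra) (subst Div (identity (+ a) (+ b) (+ d)) (∣m∣n⇒∣m-n s bd))
        where
        identity : ∀ a b d → a + b + b + d - (d + + 2 * b) ≡ a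
        identity = solve-∀
      d↛b : ¬ Div (+ b + + 2 * + d)
      d↛b db = absurd 4 (ℕ.s≤s ℕ.z≤n) (ℕ.s≤s (ℕ.s≤s (ℕ.s≤s (ℕ.s≤s (ℕ.s≤s ℕ.z≤n))))) ra
        (subst Div (identity (+ a) (+ b) (+ d)) (comb (- + 2) (+ 3) 1ℤ 0ℤ s ab db s))
        where
        identity : ∀ a b d → - + 2 * (a + b + b + d) + + 3 * (b + + 2 * a) + 1ℤ * (b + + 2 * d) + 0ℤ *
              (a + b + b + d) ≡ + 4 * a
        identity = solve-∀

    -- The last alternative speaks of the whole line because two targets of a determine the line up
    -- to order: it is {a, -2a, -2a, 3a}.
    Kind : ℕ → ℕ → ℕ → ℕ → Set
    Kind a b c d = + 31 * α ≤ V a b c d ⊎ (- + 31 * α ≤ V a b c d × Source a b c d) ⊎ 0ℤ ≤ total a b c d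

    kind : ∀ {a b c d} → InRange p a → InRange p b → InRange p c → InRange p d → Div
          (+ a + + b + + c + + d) → Kind a b c d
    kind {a} {b} {c} {d} ra rb rc rd s = decide (τ a ℕ.≟ b) (τ a ℕ.≟ c) (τ a ℕ.≟ d)
      where
      lemma₁ : ∀ a b c d → a + b + c + d ≡ a + b + d + c
      lemma₁ = solve-∀
      lemma₂ : ∀ a b c d → a + b + c + d ≡ a + c + d + b
      lemma₂ = solve-∀
      decide : Dec (τ a ≡ b) → Dec (τ a ≡ c) → Dec (τ a ≡ d) → Kind a b c d
      decide (yes ab) (yes ac) _        = inj₂ (inj₂ (two-targets ra rb rc rd s ab ac))
      decide (yes ab) (no _)   (yes ad) = inj₂ (inj₂ (subst (_≤_ 0ℤ) (total-swap₃ a b d c)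
        (two-targets ra rb rd rc (subst Div (lemma₁ (+ a) (+ b) (+ c) (+ d)) s) ab ad)))
      decide (no _)   (yes ac) (yes ad) = inj₂ (inj₂ (subst (_≤_ 0ℤ) (trans (total-swap₃ a c d b) (total-swap₂ a c b d))
        (two-targets ra rc rd rb (subst Div (lemma₂ (+ a) (+ b) (+ c) (+ d)) s) ac ad)))
      decide (yes ab) (no ac)  (no ad)  = inj₂ (inj₁ (V≥-31 ra (add₃ (e≤1 a b) (e≤0 ac) (e≤0 ad)) , inj₁ ab))
      decide (no ab)  (yes ac) (no ad)  = inj₂ (inj₁ (V≥-31 ra (add₃ (e≤0 ab) (e≤1 a c) (e≤0 ad)) , inj₂ (inj₁ ac)))
      decide (no ab)  (no ac)  (yes ad) = inj₂ (inj₁ (V≥-31 ra (add₃ (e≤0 ab) (e≤0 ac) (e≤1 a d)) , inj₂ (inj₂ ad)))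
      decide (no ab)  (no ac)  (no ad)  = inj₁ (V≥31 ra (add₃ (e≤0 ab) (e≤0 ac) (e≤0 ad)))

    -- By `no-three-sources` at most two points lose 31 α, and at least two others gain 31 α; a
    -- point with two targets is settled by `two-targets`.
    four-points : ∀ {a b c d} → InRange p a → InRange p b → InRange p c → InRange p d → Div (+ a + + b + + c + + d) →
      0ℤ ≤ total a b c d
    four-points {a} {b} {c} {d} ra rb rc rd s =
      combine (kind ra rb rc rd s) (kind rb ra rc rd (rotate permᵇ)) (kind rc ra rb rd (rotate permᶜ))
            (kind rd ra rb rc (rotate permᵈ))
      where
      rotate : ∀ {z} → + a + + b + + c + + d ≡ z → Div z
      rotate eq = subst Div eq s
      permᵇ : + a + + b + + c + + d ≡ + b + + a + + c + + d
      permᵇ = lemma (+ a) (+ b) (+ c) (+ d)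
        where
        lemma : ∀ a b c d → a + b + c + d ≡ b + a + c + d
        lemma = solve-∀
      permᶜ : + a + + b + + c + + d ≡ + c + + a + + b + + d
      permᶜ = lemma (+ a) (+ b) (+ c) (+ d)
        where
        lemma : ∀ a b c d → a + b + c + d ≡ c + a + b + d
        lemma = solve-∀
      permᵈ : + a + + b + + c + + d ≡ + d + + a + + b + + c
      permᵈ = lemma (+ a) (+ b) (+ c) (+ d)
        where
        lemma : ∀ a b c d → a + b + c + d ≡ d + a + b + c
        lemma = solve-∀
      perm′ : + a + + b + + c + + d ≡ + a + + b + + d + + c
      perm′ = lemma (+ a) (+ b) (+ c) (+ d)
        where
        lemma : ∀ a b c d → a + b + c + d ≡ a + b + d + c
        lemma = solve-∀
      perm″ : + a + + b + + c + + d ≡ + a + + c + + d + + b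
      perm″ = lemma (+ a) (+ b) (+ c) (+ d)
        where
        lemma : ∀ a b c d → a + b + c + d ≡ a + c + d + b
        lemma = solve-∀
      perm‴ : + a + + b + + c + + d ≡ + b + + c + + d + + a
      perm‴ = lemma (+ a) (+ b) (+ c) (+ d)
        where
        lemma : ∀ a b c d → a + b + c + d ≡ b + c + d + a
        lemma = solve-∀
      last-two : ∀ {a b c d} → Source a b c d → Source a b d c
      last-two (inj₁ x)        = inj₁ x
      last-two (inj₂ (inj₁ x)) = inj₂ (inj₂ x)
      last-two (inj₂ (inj₂ x)) = inj₂ (inj₁ x)
      cycle : ∀ {a b c d} → Source a b c d → Source a c d b
      cycle (inj₁ x)        = inj₂ (inj₂ x)
      cycle (inj₂ (inj₁ x)) = inj₁ x
      cycle (inj₂ (inj₂ x)) = inj₂ (inj₁ x)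
      fromUnits : ∀ i j k l → 0ℤ ≤ i + j + k + l → i * α ≤ V a b c d → j * α ≤ V b a c d → k * α ≤ V c a b d → l * α ≤ V d a b c →
        0ℤ ≤ total a b c d
      fromUnits i j k l 0≤ va vb vc vd = ℤ.≤-trans (subst (_≤_ 0ℤ) (lemma i j k l α) (nonNeg-* 0≤ 0≤α))
            (add₄ va vb vc vd)
        where
        lemma : ∀ i j k l α → (i + j + k + l) * α ≡ i * α + j * α + k * α + l * α
        lemma = solve-∀
      combine : Kind a b c d → Kind b a c d → Kind c a b d → Kind d a b c → 0ℤ ≤ total a b c d
      combine (inj₂ (inj₂ t)) _ _ _ = t
      combine _ (inj₂ (inj₂ t)) _ _ = subst (_≤_ 0ℤ) (total-swap₁ b a c d) t
      combine _ _ (inj₂ (inj₂ t)) _ = subst (_≤_ 0ℤ) (trans (total-swap₁ c a b d) (total-swap₂ a c b d)) t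
      combine _ _ _ (inj₂ (inj₂ t)) = subst (_≤_ 0ℤ) (trans (total-swap₁ d a b c) (trans (total-swap₂ a d b c)
            (total-swap₃ a b d c))) t
      combine (inj₂ (inj₁ (_ , sa))) (inj₂ (inj₁ (_ , sb))) (inj₂ (inj₁ (_ , sc))) _ = ⊥-elim
            (no-three-sources ra rb rc rd s sa sb sc)
      combine (inj₂ (inj₁ (_ , sa))) (inj₂ (inj₁ (_ , sb))) _ (inj₂ (inj₁ (_ , sd))) =
        ⊥-elim (no-three-sources ra rb rd rc (rotate perm′) (last-two sa) (last-two sb) sd)
      combine (inj₂ (inj₁ (_ , sa))) _ (inj₂ (inj₁ (_ , sc))) (inj₂ (inj₁ (_ , sd))) =
        ⊥-elim (no-three-sources ra rc rd rb (rotate perm″) (cycle sa) (last-two sc) (last-two sd))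
      combine _ (inj₂ (inj₁ (_ , sb))) (inj₂ (inj₁ (_ , sc))) (inj₂ (inj₁ (_ , sd))) =
        ⊥-elim (no-three-sources rb rc rd ra (rotate perm‴) (cycle sb) (cycle sc) (cycle sd))
      combine (inj₁ va) (inj₁ vb) (inj₁ vc) (inj₁ vd) = fromUnits (+ 31) (+ 31) (+ 31) (+ 31) (nat 124) va vb vc vd
      combine (inj₁ va) (inj₁ vb) (inj₁ vc) (inj₂ (inj₁ (vd , _))) = fromUnits (+ 31) (+ 31) (+ 31) (- + 31)
            (nat 62) va vb vc vd
      combine (inj₁ va) (inj₁ vb) (inj₂ (inj₁ (vc , _))) (inj₁ vd) = fromUnits (+ 31) (+ 31) (- + 31) (+ 31)
            (nat 62) va vb vc vd
      combine (inj₁ va) (inj₁ vb) (inj₂ (inj₁ (vc , _))) (inj₂ (inj₁ (vd , _))) = fromUnits (+ 31) (+ 31)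
            (- + 31) (- + 31) (nat 0) va vb vc vd
      combine (inj₁ va) (inj₂ (inj₁ (vb , _))) (inj₁ vc) (inj₁ vd) = fromUnits (+ 31) (- + 31) (+ 31) (+ 31)
            (nat 62) va vb vc vd
      combine (inj₁ va) (inj₂ (inj₁ (vb , _))) (inj₁ vc) (inj₂ (inj₁ (vd , _))) = fromUnits (+ 31) (- + 31)
            (+ 31) (- + 31) (nat 0) va vb vc vd
      combine (inj₁ va) (inj₂ (inj₁ (vb , _))) (inj₂ (inj₁ (vc , _))) (inj₁ vd) = fromUnits (+ 31) (- + 31)
            (- + 31) (+ 31) (nat 0) va vb vc vd
      combine (inj₂ (inj₁ (va , _))) (inj₁ vb) (inj₁ vc) (inj₁ vd) = fromUnits (- + 31) (+ 31) (+ 31) (+ 31)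
            (nat 62) va vb vc vd
      combine (inj₂ (inj₁ (va , _))) (inj₁ vb) (inj₁ vc) (inj₂ (inj₁ (vd , _))) = fromUnits (- + 31) (+ 31)
            (+ 31) (- + 31) (nat 0) va vb vc vd
      combine (inj₂ (inj₁ (va , _))) (inj₁ vb) (inj₂ (inj₁ (vc , _))) (inj₁ vd) = fromUnits (- + 31) (+ 31)
            (- + 31) (+ 31) (nat 0) va vb vc vd
      combine (inj₂ (inj₁ (va , _))) (inj₂ (inj₁ (vb , _))) (inj₁ vc) (inj₁ vd) = fromUnits (- + 31) (- + 31)
            (+ 31) (+ 31) (nat 0) va vb vc vd

  -- Permutations of the residues, and a potential for lines with at least five points.

  module Reindex (p : ℕ) (p-prime : Prime p) (7≤p : 7 ℕ.≤ p) where
    open Modular p p-prime 7≤p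
    open Scaling p p-prime 7≤p
    open Doubling p p-prime 7≤p
    open Residues p

    R-comm : ∀ (g : ℕ → ℕ → ℤ) → R (λ x → R (λ y → g x y)) ≡ R (λ y → R (λ x → g x y))
    R-comm g = ∑-comm {p ℕ.∸ 1} {p ℕ.∸ 1} (λ i j → g (suc (toℕ i)) (suc (toℕ j)))

    τ-range : ∀ {x} → InRange p x → InRange p (τ x)
    τ-range {x} rx = ℕ.n≢0⇒n>0 (λ τx≡0 → absurd 2 0<2 2<7 rx (subst Div (ℤ.+-identityˡ _) (τ-Div τx≡0))) , m%n<n
          (neg 2 ℕ.* x) p

    -- Written with indicators, the change of variables is an exchange of two sums. Bijectivity
    -- enters in the form `eq y (σ x) ≡ eq x (σ⁻¹ y)`.
    R-permute : ∀ (σ σ⁻¹ : ℕ → ℕ) → (∀ {x} → InRange p x → InRange p (σ x)) → (∀ {x} → InRange p x → InRange p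
          (σ⁻¹ x)) →
      (∀ {x y} → InRange p x → InRange p y → eq y (σ x) ≡ eq x (σ⁻¹ y)) → ∀ h → R (h ∘ σ) ≡ R h
    R-permute σ σ⁻¹ σ-range σ⁻¹-range inverse-eq h = begin
      R (h ∘ σ)                                ≡⟨ R-cong (h ∘ σ) (λ x → R (λ y → eq y (σ x) * h y)) (λ rx → sym
            (R-eq (σ-range rx) h)) ⟩
      R (λ x → R (λ y → eq y (σ x) * h y))     ≡⟨ R-comm (λ x y → eq y (σ x) * h y) ⟩
      R (λ y → R (λ x → eq y (σ x) * h y))     ≡⟨ R-cong _ (λ y → R (λ x → eq x (σ⁻¹ y) * h y)) (λ {y} ry →
                                                    R-cong _ (λ x → eq x (σ⁻¹ y) * h y) (λ {x} rx → cong
                                                          (_* h y) (inverse-eq rx ry))) ⟩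
      R (λ y → R (λ x → eq x (σ⁻¹ y) * h y))   ≡⟨ R-cong _ h (λ {y} ry → R-eq (σ⁻¹-range ry) (λ _ → h y)) ⟩
      R h                                      ∎
      where
      open ≡-Reasoning

    R-neg : ∀ h → R (h ∘ neg) ≡ R h
    R-neg = R-permute neg neg neg-range neg-range inverse-eq
      where
      inverse-eq : ∀ {x y} → InRange p x → InRange p y → eq y (neg x) ≡ eq x (neg y)
      inverse-eq {x} {y} rx ry with y ℕ.≟ neg x
      ... | yes y≡-x = sym (eq-≡ (trans (sym (neg-neg (proj₂ rx))) (cong neg (sym y≡-x))))
      ... | no  y≢-x = sym (eq-≢ (λ x≡-y → y≢-x (trans (sym (neg-neg (proj₂ ry))) (cong neg (sym x≡-y)))))

    R-τ : ∀ h → R (h ∘ τ) ≡ R h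
    R-τ = R-permute τ μ τ-range μ-range inverse-eq
      where
      inv = inverse (neg-range range-2)
      open By {proj₁ inv} {neg 2} (proj₂ inv)
      comm : ∀ y a x → y - a * x ≡ y - x * a
      comm = solve-∀
      cancel : ∀ y t w → y - w - (t - w) ≡ y - t
      cancel = solve-∀
      inverse-eq : ∀ {x y} → InRange p x → InRange p y → eq y (τ x) ≡ eq x (μ y)
      inverse-eq {x} {y} rx ry with y ℕ.≟ τ x
      ... | yes y≡τx = sym (eq-≡ (sym (μ-to (proj₂ rx) (subst Div (comm (+ y) (+ neg 2) (+ x))
            (subst (λ z → Div (+ z - + neg 2 * + x)) (sym y≡τx) (Div-scale (neg 2) x))))))
      ... | no y≢τx = sym (eq-≢ (λ x≡μy → y≢τx (Div-≡ (proj₂ ry) (proj₂ (τ-range rx))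
            (subst Div (cancel (+ y) (+ τ x) (+ neg 2 * + x))
              (∣m∣n⇒∣m-n (subst Div (comm (+ y) (+ x) (+ neg 2)) (μ-from (sym x≡μy))) (Div-scale (neg 2) x))))))

  -- The potential 36α n(n − 1), summed over all symbols, is invariant under x ↦ −2x.
  module Potential (α w : ℤ) (0≤α : 0ℤ ≤ α) (α≤w : 0ℤ ≤ w - α) (w≤α : 0ℤ ≤ + 18 * α - + 13 * w) where

    -- From 13 w ≤ 18 α follows 52 w ≤ 72 α, and 36 is half of 72. For i < j, a loss 52 w i (j - i)
    -- is then at most φ j - φ i = 36 α (j - i)(i + j - 1), since i + j - 1 ≥ 2 i.
    φ : ℤ → ℤ
    φ n = + 36 * α * (n * (n - 1ℤ))

    private
      0≤w : 0ℤ ≤ w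
      0≤w = subst (_≤_ 0ℤ) (lemma w α) (nonNeg-+ α≤w 0≤α)
        where
        lemma : ∀ w α → w - α + α ≡ w
        lemma = solve-∀

      surplus : ∀ m → 0ℤ ≤ m - + 5 → 0ℤ ≤ + 31 * (m - + 5) + + 10
      surplus m 5≤m = nonNeg-+ (nonNeg-* (nat 31) 5≤m) (nat 10)

    -- The case of w = α and k = i - j > 0, divided by α: the gain 52 i k against the potential
    -- difference 36 (2 i k - k² - k) leaves -20 i k + 36 k + 36 k². For i ≤ 5 the expression is
    -- expanded at k = 1. For i ≥ 6 the square of 2 i - 6 k absorbs the negative term, at the
    -- expense of 31 i m, and m ≥ i is used.
    quadratic : ∀ i k m → 0ℤ ≤ i → 1ℤ ≤ k → 0ℤ ≤ m - + 5 → 0ℤ ≤ m - i →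
      0ℤ ≤ + 10 * i + + 31 * i * (m - + 5) - + 20 * i * k + + 36 * k + + 36 * (k * k)
    quadratic i k m 0≤i 1≤k 5≤m i≤m with i ℤ.≤? + 5
    ... | yes i≤5 = subst (_≤_ 0ℤ) (lemma i k m)
          (nonNeg-+ (nonNeg-+ (nonNeg-+ (nonNeg-+ (nat 22) (nonNeg-* (nat 10) (diff i≤5)))
            (nonNeg-* (diff 1≤k) (nonNeg-+ (nat 8) (nonNeg-* (nat 20) (diff i≤5)))))
            (nonNeg-* (nat 36) (nonNeg-square (k - 1ℤ)))) (nonNeg-* (nonNeg-* (nat 31) 0≤i) 5≤m))
      where
      lemma : ∀ i k m → + 22 + + 10 * (+ 5 - i) + (k - 1ℤ) * (+ 8 + + 20 * (+ 5 - i)) + + 36 * ((k - 1ℤ) *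
            (k - 1ℤ)) + + 31 * i * (m - + 5)
        ≡ + 10 * i + + 31 * i * (m - + 5) - + 20 * i * k + + 36 * k + + 36 * (k * k)
      lemma = solve-∀
    ... | no i≰5 = subst (_≤_ 0ℤ) (lemma i k m)
          (nonNeg-+ (nonNeg-+ (nonNeg-+ (nonNeg-+ (nonNeg-square (+ 2 * i - + 6 * k)) (nonNeg-* (nonNeg-*
                (nat 4) 0≤i) 0≤k))
            (nonNeg-* 0≤i (nonNeg-+ (nonNeg-* (nat 27) (diff (ℤ.i<j⇒suc[i]≤j (ℤ.≰⇒> i≰5)))) (nat 17))))
            (nonNeg-* (nat 36) 0≤k)) (nonNeg-* (nonNeg-* (nat 31) 0≤i) i≤m))
      where
      0≤k : 0ℤ ≤ k
      0≤k = ℤ.≤-trans (nat 1) 1≤k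
      lemma : ∀ i k m → (+ 2 * i - + 6 * k) * (+ 2 * i - + 6 * k) + + 4 * i * k + i * (+ 27 *
            (i - + 6) + + 17) + + 36 * k + + 31 * i * (m - i)
        ≡ + 10 * i + + 31 * i * (m - + 5) - + 20 * i * k + + 36 * k + + 36 * (k * k)
      lemma = solve-∀

    potential-step : ∀ i j m n → 0ℤ ≤ i → 0ℤ ≤ m - + 5 → 0ℤ ≤ m - i → 0ℤ ≤ n →
      φ i + - 1ℤ * φ j ≤ i * (w * (+ 31 * (m + n) - + 52 * (j - i) - + 145))
    potential-step i j m n 0≤i 5≤m i≤m 0≤n with ℤ.<-cmp i j
    ... | tri< i<j _ _ = ≤-from
          (nonNeg-+ (nonNeg-+ (nonNeg-+ (nonNeg-* 0≤i (nonNeg-* 0≤w (surplus m 5≤m)))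
            (nonNeg-* (nonNeg-* (nat 4) w≤α) (nonNeg-* 0≤i (diff (ℤ.<⇒≤ i<j)))))
            (nonNeg-* (nonNeg-* (nat 36) 0≤α) (nonNeg-* (diff (ℤ.<⇒≤ i<j)) (diff (ℤ.i<j⇒suc[i]≤j i<j)))))
            (nonNeg-* (nat 31) (nonNeg-* 0≤w (nonNeg-* 0≤i 0≤n))))
          (lemma i j m n w α)
      where
      lemma : ∀ i j m n w α → i * (w * (+ 31 * (m - + 5) + + 10)) + + 4 * (+ 18 * α - + 13 * w) * (i * (j - i))
          + + 36 * α * ((j - i) * (j - (1ℤ + i))) + + 31 * (w * (i * n))
        ≡ i * (w * (+ 31 * (m + n) - + 52 * (j - i) - + 145)) - (+ 36 * α * (i * (i - 1ℤ)) + - 1ℤ * (+ 36 * α *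
              (j * (j - 1ℤ))))
      lemma = solve-∀
    ... | tri≈ _ refl _ = ≤-from
          (nonNeg-+ (nonNeg-* 0≤i (nonNeg-* 0≤w (surplus m 5≤m))) (nonNeg-* (nat 31) (nonNeg-* 0≤w (nonNeg-* 0≤i 0≤n))))
          (lemma i m n w α)
      where
      lemma : ∀ i m n w α → i * (w * (+ 31 * (m - + 5) + + 10)) + + 31 * (w * (i * n))
        ≡ i * (w * (+ 31 * (m + n) - + 52 * (i - i) - + 145)) - (+ 36 * α * (i * (i - 1ℤ)) + - 1ℤ * (+ 36 * α *
              (i * (i - 1ℤ))))
      lemma = solve-∀
    ... | tri> _ _ j<i = ≤-from
          (nonNeg-+ (nonNeg-+ (nonNeg-* 0≤α (quadratic i (i - j) m 0≤i 1≤i-j 5≤m i≤m))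
            (nonNeg-* α≤w (nonNeg-* 0≤i (nonNeg-+ (nonNeg-* (nat 52) (ℤ.≤-trans (nat 1) 1≤i-j)) (surplus m 5≤m)))))
            (nonNeg-* (nat 31) (nonNeg-* 0≤w (nonNeg-* 0≤i 0≤n))))
          (lemma i j m n w α)
      where
      1≤i-j : 1ℤ ≤ i - j
      1≤i-j = ≤-from (diff (ℤ.i<j⇒suc[i]≤j j<i)) (lemma i j)
        where
        lemma : ∀ i j → i - (1ℤ + j) ≡ i - j - 1ℤ
        lemma = solve-∀
      lemma : ∀ i j m n w α →
        α * (+ 10 * i + + 31 * i * (m - + 5) - + 20 * i * (i - j) + + 36 * (i - j) + + 36 * ((i - j) * (i - j)))
          + (w - α) * (i * (+ 52 * (i - j) + (+ 31 * (m - + 5) + + 10))) + + 31 * (w * (i * n))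
        ≡ i * (w * (+ 31 * (m + n) - + 52 * (j - i) - + 145)) - (+ 36 * α * (i * (i - 1ℤ)) + - 1ℤ * (+ 36 * α *
              (j * (j - 1ℤ))))
      lemma = solve-∀

  lsum-↭ : ∀ f {xs ys} → xs ↭ ys → lsum f xs ≡ lsum f ys
  lsum-↭ f ↭-refl = refl
  lsum-↭ f (prep x xs↭ys) = cong (_+_ (f x)) (lsum-↭ f xs↭ys)
  lsum-↭ f (swap {xs} {ys} x y xs↭ys) = trans (cong (λ s → f x + (f y + s)) (lsum-↭ f xs↭ys)) (lemma (f x) (f y)
        (lsum f ys))
    where
    lemma : ∀ a b c → a + (b + c) ≡ b + (a + c)
    lemma = solve-∀
  lsum-↭ f (↭-trans xs↭ys ys↭zs) = trans (lsum-↭ f xs↭ys) (lsum-↭ f ys↭zs)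

  front₂ : ∀ (a b : ℕ) r → b ∷ a ∷ r ↭ a ∷ b ∷ r
  front₂ a b r = swap b a ↭-refl

  front₃ : ∀ (a b c : ℕ) r → c ∷ a ∷ b ∷ r ↭ a ∷ b ∷ c ∷ r
  front₃ a b c r = ↭-trans (front₂ a c (b ∷ r)) (prep a (front₂ b c r))

  front₄ : ∀ (a b c d : ℕ) → d ∷ a ∷ b ∷ c ∷ [] ↭ a ∷ b ∷ c ∷ d ∷ []
  front₄ a b c d = ↭-trans (front₂ a d (b ∷ c ∷ [])) (prep a (front₃ b c d []))

  -- The weighted inequality on a single line.

  module Lines (p : ℕ) (p-prime : Prime p) (7≤p : 7 ℕ.≤ p) (ω : ℕ → ℤ) (α : ℤ) (0≤α : 0ℤ ≤ α)
    (ω-lower : ∀ {x} → InRange p x → α ≤ ω x) (ω-upper : ∀ {x} → InRange p x → + 13 * ω x ≤ + 18 * α) where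
    open Modular p p-prime 7≤p
    open Doubling p p-prime 7≤p
    open Weights p p-prime 7≤p ω α 0≤α ω-lower ω-upper
    open Residues p
    open Reindex p p-prime 7≤p

    B : ℕ → ℕ → ℤ
    B x y = ω x * + 31 * (one y + eq (neg x) y) + - (ω x * + 52) * (1ℤ * eq (τ x) y + - 1ℤ * eq x y)

    C : ℕ → ℤ
    C x = ω x * + 145

    value : List ℕ → ℕ → ℤ
    value xs x = ω x * (+ 31 * (lsum one xs + # (neg x) xs) - + 52 * (# (τ x) xs - # x xs) - + 145)

    lsum-B : ∀ xs x → lsum (B x) xs ≡ ω x * + 31 * (lsum one xs + # (neg x) xs) + - (ω x * + 52) * (1ℤ * #
          (τ x) xs + - 1ℤ * # x xs)
    lsum-B xs x = trans (lsum-linear (ω x * + 31) (- (ω x * + 52)) (λ y → one y + eq (neg x) y) (λ y → 1ℤ * eq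
          (τ x) y + - 1ℤ * eq x y) xs)
      (cong₂ (λ s t → ω x * + 31 * s + - (ω x * + 52) * t) (lsum-+ one (eq (neg x)) xs) (lsum-linear 1ℤ (- 1ℤ)
            (eq (τ x)) (eq x) xs))

    B-value : ∀ xs x → lsum (B x) xs - C x ≡ value xs x
    B-value xs x = trans (cong (_- C x) (lsum-B xs x)) (lemma (ω x) (lsum one xs) (# (neg x) xs) (# (τ x) xs) (# x xs))
      where
      lemma : ∀ w m n t s → w * + 31 * (m + n) + - (w * + 52) * (1ℤ * t + - 1ℤ * s) - w * + 145 ≡ w * (+ 31 *
            (m + n) - + 52 * (t - s) - + 145)
      lemma = solve-∀

    value-↭ : ∀ {xs ys} x → xs ↭ ys → value xs x ≡ value ys x
    value-↭ {xs} {ys} x σ = trans (sym (B-value xs x)) (trans (cong (_- C x) (lsum-↭ (B x) σ)) (B-value ys x))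

    head₂ : ∀ {a b} → InRange p a → InRange p b → Div (+ b + + a) → 0ℤ ≤ value (a ∷ b ∷ []) a
    head₂ {a} {b} ra rb d = nonNeg-* (0≤ω ra) (subst (_≤_ 0ℤ) eqn (nonNeg-+ (nonNeg-* (nat 31) (0≤eq (neg a) a))
          (nonNeg-* (nat 52) (0≤eq a b))))
      where
      f : ℤ → ℤ → ℤ → ℤ → ℤ → ℤ → ℤ
      f n₁ n₂ t₁ t₂ s₁ s₂ = + 31 * (+ 2 + (n₁ + (n₂ + 0ℤ))) - + 52 * ((t₁ + (t₂ + 0ℤ)) - (s₁ + (s₂ + 0ℤ))) - + 145
      lemma : ∀ n s → + 31 * n + + 52 * s ≡ + 31 * (+ 2 + (n + (1ℤ + 0ℤ))) - + 52 * ((0ℤ + (0ℤ + 0ℤ)) - (1ℤ +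
            (s + 0ℤ))) - + 145
      lemma = solve-∀
      diff-a : ∀ a b → b + + 2 * a - (b + a) ≡ a
      diff-a = solve-∀
      τa≢b : τ a ≢ b
      τa≢b τa≡b = ∤small (proj₁ ra) (proj₂ ra) (subst Div (diff-a (+ a) (+ b)) (∣m∣n⇒∣m-n (τ-Div τa≡b) d))
      n₂≡1 : eq (neg a) b ≡ 1ℤ
      n₂≡1 = eq-≡ (sym (neg-unique (proj₂ rb) ra d))
      eqn : + 31 * eq (neg a) a + + 52 * eq a b ≡ f (eq (neg a) a) (eq (neg a) b) (eq (τ a) a) (eq (τ a) b)
            (eq a a) (eq a b)
      eqn rewrite n₂≡1 | eq-≢ (τ-≢ ra) | eq-≢ τa≢b | eq-refl a = lemma (eq (neg a) a) (eq a b)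

    -- If b = -2a, then c = -a - b = a.
    third-point : ∀ {a b c} → InRange p a → InRange p c → Div (+ a + + b + + c) → eq (τ a) b ≤ eq a c
    third-point {a} {b} {c} ra rc d = decide (τ a ℕ.≟ b)
      where
      lemma : ∀ a b c → a + b + c - (b + + 2 * a) ≡ c - a
      lemma = solve-∀
      decide : Dec (τ a ≡ b) → eq (τ a) b ≤ eq a c
      decide (yes τa≡b) = subst (eq (τ a) b ≤_) (sym (eq-≡ (sym (Div-≡ (proj₂ rc) (proj₂ ra)
        (subst Div (lemma (+ a) (+ b) (+ c)) (∣m∣n⇒∣m-n d (τ-Div τa≡b))))))) (eq≤1 (τ a) b)
      decide (no τa≢b) = subst (_≤ eq a c) (sym (eq-≢ τa≢b)) (0≤eq a c)

    head₃ : ∀ {a b c} → InRange p a → InRange p b → InRange p c → Div (+ a + + b + + c) → 0ℤ ≤ value (a ∷ b ∷ c ∷ []) a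
    head₃ {a} {b} {c} ra rb rc d = nonNeg-* (0≤ω ra) (subst (_≤_ 0ℤ) eqn (nonNeg-+ (nonNeg-* (nat 31) (0≤#
          (neg a) (a ∷ b ∷ c ∷ [])))
        (nonNeg-* (nat 52) (nonNeg-+ (diff (third-point ra rc d)) (diff (third-point ra rb (subst Div (swap₂
              (+ a) (+ b) (+ c)) d)))))))
      where
      swap₂ : ∀ a b c → a + b + c ≡ a + c + b
      swap₂ = solve-∀
      N = # (neg a) (a ∷ b ∷ c ∷ [])
      lemma : ∀ n t₁ t₂ s₁ s₂ → + 31 * n + + 52 * ((s₂ - t₁) + (s₁ - t₂))
        ≡ + 31 * (+ 3 + n) - + 52 * ((0ℤ + (t₁ + (t₂ + 0ℤ))) - (1ℤ + (s₁ + (s₂ + 0ℤ)))) - + 145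
      lemma = solve-∀
      f : ℤ → ℤ → ℤ
      f t s = + 31 * (+ 3 + N) - + 52 * ((t + (eq (τ a) b + (eq (τ a) c + 0ℤ))) - (s + (eq a b +
            (eq a c + 0ℤ)))) - + 145
      eqn : + 31 * N + + 52 * ((eq a c - eq (τ a) b) + (eq a b - eq (τ a) c)) ≡ f (eq (τ a) a) (eq a a)
      eqn = trans (lemma N (eq (τ a) b) (eq (τ a) c) (eq a b) (eq a c)) (sym (cong₂ f {eq
            (τ a) a} {0ℤ} {eq a a} {1ℤ} (eq-≢ (τ-≢ ra)) (eq-refl a)))

    head₄ : ∀ {a b c d} → InRange p a → V a b c d ≤ value (a ∷ b ∷ c ∷ d ∷ []) a
    head₄ {a} {b} {c} {d} ra = ≤-from (nonNeg-* (nonNeg-* (nat 31) (0≤ω ra)) (0≤# (neg a) (a ∷ b ∷ c ∷ d ∷ []))) eqn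
      where
      N = # (neg a) (a ∷ b ∷ c ∷ d ∷ [])
      f : ℤ → ℤ → ℤ
      f t s = ω a * (+ 31 * (+ 4 + N) - + 52 * ((t + (eq (τ a) b + (eq (τ a) c + (eq (τ a) d + 0ℤ)))) - (s +
            (eq a b + (eq a c + (eq a d + 0ℤ))))) - + 145) - V a b c d
      lemma : ∀ w n t₁ t₂ t₃ s₁ s₂ s₃ → + 31 * w * n
        ≡ w * (+ 31 * (+ 4 + n) - + 52 * ((0ℤ + (t₁ + (t₂ + (t₃ + 0ℤ)))) - (1ℤ + (s₁ + (s₂ + (s₃ + 0ℤ))))) - + 145)
          - w * (+ 31 - + 52 * ((t₁ - s₁) + (t₂ - s₂) + (t₃ - s₃)))
      lemma = solve-∀
      eqn : + 31 * ω a * N ≡ f (eq (τ a) a) (eq a a)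
      eqn = trans (lemma (ω a) N (eq (τ a) b) (eq (τ a) c) (eq (τ a) d) (eq a b) (eq a c) (eq a d)) (sym
            (cong₂ f {eq (τ a) a} {0ℤ} {eq a a} {1ℤ} (eq-≢ (τ-≢ ra)) (eq-refl a)))

    five-points : ∀ xs → (∀ {x} → x ∈ xs → InRange p x) → + 5 ≤ lsum one xs → 0ℤ ≤ lsum (value xs) xs
    five-points xs r 5≤m = subst₂ _≤_ zero-sum (sym (lsum-R (value xs) xs r))
      (R-mono (λ x → φ (# x xs) + - 1ℤ * φ (# (τ x) xs)) (λ x → # x xs * value xs x) (λ {x} rx →
        Potential.potential-step α (ω x) 0≤α (diff (ω-lower rx)) (diff (ω-upper rx)) (# x xs) (# (τ x) xs)
              (lsum one xs) (# (neg x) xs)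
          (0≤# x xs) (diff 5≤m) (#≤length x) (0≤# (neg x) xs)))
      where
      φ : ℤ → ℤ
      φ n = + 36 * α * (n * (n - 1ℤ))
      lemma : ∀ a → a + - 1ℤ * a ≡ 0ℤ
      lemma = solve-∀
      zero-sum : R (λ x → φ (# x xs) + - 1ℤ * φ (# (τ x) xs)) ≡ 0ℤ
      zero-sum = trans (R-+ (λ x → φ (# x xs)) (λ x → - 1ℤ * φ (# (τ x) xs)))
        (trans (cong (_+_ (R (λ x → φ (# x xs)))) (trans (R-* (- 1ℤ) (λ x → φ (# (τ x) xs))) (cong (_*_ (- 1ℤ))
              (R-τ (λ x → φ (# x xs))))))
          (lemma (R (λ x → φ (# x xs)))))
      #≤length : ∀ x → 0ℤ ≤ lsum one xs - # x xs
      #≤length x = subst (_≤_ 0ℤ) (trans (lsum-linear 1ℤ (- 1ℤ) one (eq x) xs) (tidy (lsum one xs) (# x xs)))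
        (lsum-nonNeg xs (λ {y} _ → subst (_≤_ 0ℤ) (tidy′ (eq x y)) (diff (eq≤1 x y))))
        where
        tidy : ∀ a b → 1ℤ * a + - 1ℤ * b ≡ a - b
        tidy = solve-∀
        tidy′ : ∀ b → 1ℤ - b ≡ 1ℤ * 1ℤ + - 1ℤ * b
        tidy′ = solve-∀

    line-inequality : ∀ xs → ZeroSum p xs → 0ℤ ≤ lsum (value xs) xs
    line-inequality [] zs = nat 0
    line-inequality (a ∷ []) zs = ⊥-elim (∤small (proj₁ ra) (proj₂ ra) (subst Div (ℤ.+-identityʳ (+ a)) (sum-Div zs)))
      where
      ra = ZeroSum.range zs (here refl)
    line-inequality (a ∷ b ∷ []) zs = nonNeg-+ (head₂ ra rb (subst Div (lemma₁ (+ a) (+ b)) (sum-Div zs)))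
      (nonNeg-+ (subst (_≤_ 0ℤ) (value-↭ b (front₂ a b [])) (head₂ rb ra (subst Div (lemma₂ (+ a) (+ b))
            (sum-Div zs)))) (nat 0))
      where
      ra = ZeroSum.range zs (here refl)
      rb = ZeroSum.range zs (there (here refl))
      lemma₁ : ∀ a b → a + (b + 0ℤ) ≡ b + a
      lemma₁ = solve-∀
      lemma₂ : ∀ a b → a + (b + 0ℤ) ≡ a + b
      lemma₂ = solve-∀
    line-inequality (a ∷ b ∷ c ∷ []) zs = nonNeg-+ (head₃ ra rb rc (subst Div (lemma₁ (+ a) (+ b) (+ c)) (sum-Div zs)))
      (nonNeg-+ (subst (_≤_ 0ℤ) (value-↭ b (front₂ a b (c ∷ []))) (head₃ rb ra rc (subst Div (lemma₂ (+ a) (+ b)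
            (+ c)) (sum-Div zs))))
        (nonNeg-+ (subst (_≤_ 0ℤ) (value-↭ c (front₃ a b c []))
          (head₃ rc ra rb (subst Div (lemma₃ (+ a) (+ b) (+ c)) (sum-Div zs)))) (nat 0)))
      where
      ra = ZeroSum.range zs (here refl)
      rb = ZeroSum.range zs (there (here refl))
      rc = ZeroSum.range zs (there (there (here refl)))
      lemma₁ : ∀ a b c → a + (b + (c + 0ℤ)) ≡ a + b + c
      lemma₁ = solve-∀
      lemma₂ : ∀ a b c → a + (b + (c + 0ℤ)) ≡ b + a + c
      lemma₂ = solve-∀
      lemma₃ : ∀ a b c → a + (b + (c + 0ℤ)) ≡ c + a + b
      lemma₃ = solve-∀
    line-inequality (a ∷ b ∷ c ∷ d ∷ []) zs = ℤ.≤-trans (four-points ra rb rc rd (subst Div (lemma (+ a) (+ b)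
          (+ c) (+ d)) (sum-Div zs)))
      (subst (total a b c d ≤_) (sym (lemma (value xs a) (value xs b) (value xs c) (value xs d)))
        (add₄ (head₄ ra) (subst (V b a c d ≤_) (value-↭ b (front₂ a b (c ∷ d ∷ []))) (head₄ rb))
          (subst (V c a b d ≤_) (value-↭ c (front₃ a b c (d ∷ []))) (head₄ rc))
          (subst (V d a b c ≤_) (value-↭ d (front₄ a b c d)) (head₄ rd))))
      where
      xs = a ∷ b ∷ c ∷ d ∷ []
      ra = ZeroSum.range zs (here refl)
      rb = ZeroSum.range zs (there (here refl))
      rc = ZeroSum.range zs (there (there (here refl)))
      rd = ZeroSum.range zs (there (there (there (here refl))))
      lemma : ∀ a b c d → a + (b + (c + (d + 0ℤ))) ≡ a + b + c + d
      lemma = solve-∀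
    line-inequality xs@(_ ∷ _ ∷ _ ∷ _ ∷ _ ∷ r) zs = five-points xs (ZeroSum.range zs)
      (≤-from (lsum-nonNeg {one} r (λ _ → nat 1)) (lemma (lsum one r)))
      where
      lemma : ∀ s → s ≡ 1ℤ + (1ℤ + (1ℤ + (1ℤ + (1ℤ + s)))) - + 5
      lemma = solve-∀

  -- Integral weights and the sum over all lines.

  -- An integral stand-in for 1/z: M! is a common multiple of all class sizes up to M. The value 0
  -- for z ≤ 0 is a default.
  share : ℕ → ℤ → ℤ
  share M (+ suc k) = + (M ! ℕ./ suc k)
  share M _         = 0ℤ

  share-* : ∀ M z → 0ℤ < z → z ≤ + M → share M z * z ≡ + (M !)
  share-* M (+ suc k) _ (+≤+ k<M) = trans (sym (ℤ.pos-* (M ! ℕ./ suc k) (suc k)))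
    (cong +_ (m/n*n≡m (∣-trans (m∣m*n (k !)) (m≤n⇒m!∣n! k<M))))
  share-* M (+ zero) (+<+ ()) _

  module Contradiction (p : ℕ) (p-prime : Prime p) (7≤p : 7 ℕ.≤ p) (all : List ℕ)
    (range : ∀ {x} → x ∈ all → InRange p x) (pencil : Pencil p all) (allLines : AllLines p all)
    (light : lsum one all ≤ + 2 * + (p ℕ.* p) - + 2 * + p + + 4)
    (third : ∀ x → ∃[ z ] (z ∈ all × z ≢ x × z ≢ p ℕ.∸ x)) where
    open Modular p p-prime 7≤p
    open Doubling p p-prime 7≤p
    open Residues p
    open Reindex p p-prime 7≤p
    open Word p p-prime 7≤p all range pencil light using (class-size; 1≤2P-1; W; slack; vanish)
    open Symbols p p-prime 7≤p all range pencil light third using (class-upper)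
    open Full p p-prime 7≤p all range pencil light third using (all-symbols)

    m : ℕ
    m = 2 ℕ.* p ℕ.+ 3

    +M : + suc m ≡ + 2 * P + + 4
    +M = trans (cong (_+_ 1ℤ) (trans (ℤ.pos-+ (2 ℕ.* p) 3) (cong (_+ + 3) (ℤ.pos-* 2 p)))) (lemma (+ 2 * P))
      where
      lemma : ∀ a → 1ℤ + (a + + 3) ≡ a + + 4
      lemma = solve-∀

    -- `suc m` is 2 p + 4, the upper bound for class sizes, so α = Λ / (2 p + 4) is the weight that
    -- a class of that size would have, a lower bound for all weights.
    α Λ : ℤ
    α = + (m !)
    Λ = + (suc m !)

    ω : ℕ → ℤ
    ω x = share (suc m) (# x all)

    Λ≡ : Λ ≡ (+ 2 * P + + 4) * α
    Λ≡ = trans (ℤ.pos-* (suc m) (m !)) (cong (_* α) +M)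

    module _ {x : ℕ} (rx : InRange p x) where
      private
        s : ℤ
        s = # x all

        lower : 0ℤ ≤ s - (+ 2 * P - 1ℤ)
        lower = diff (class-size (all-symbols rx))

        upper : s ≤ + 2 * P + + 4
        upper = class-upper (all-symbols rx)

        0<s : 0ℤ < s
        0<s = ℤ.<-≤-trans (+<+ (ℕ.s≤s ℕ.z≤n)) (ℤ.≤-trans 1≤2P-1 (class-size (all-symbols rx)))

      ω-size : ω x * s ≡ Λ
      ω-size = share-* (suc m) s 0<s (subst (s ≤_) (sym +M) upper)

      ω-lower : α ≤ ω x
      ω-lower = ℤ.0≤i-j⇒j≤i (nonNeg-cancel s 0<s (subst (_≤_ 0ℤ)
          (trans (lemma₁ (+ 2 * P + + 4) s α) (trans (cong (_- s * α) (trans (sym Λ≡) (sym ω-size))) (lemma₂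
                (ω x) s α)))
          (nonNeg-* (diff upper) (nat (m !)))))
        where
        lemma₁ : ∀ M s a → (M - s) * a ≡ M * a - s * a
        lemma₁ = solve-∀
        lemma₂ : ∀ w s a → w * s - s * a ≡ s * (w - a)
        lemma₂ = solve-∀

      -- The ratio of ω to α is (2 p + 4)/s ≤ (2 p + 4)/(2 p - 1), which decreases in p and equals
      -- 18/13 at p = 7.
      ω-upper : + 13 * ω x ≤ + 18 * α
      ω-upper = ℤ.0≤i-j⇒j≤i (nonNeg-cancel s 0<s (subst (_≤_ 0ℤ)
          (trans (lemma₁ P s α) (trans (cong (λ z → + 18 * α * s - + 13 * z) (trans (sym Λ≡) (sym ω-size)))
                (lemma₂ (ω x) s α)))
          (nonNeg-* (nonNeg-+ (nonNeg-* (nat 18) lower) (nonNeg-* (nat 10) 0≤P-7)) (nat (m !)))))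
        where
        lemma₁ : ∀ p s a → (+ 18 * (s - (+ 2 * p - 1ℤ)) + + 10 * (p - + 7)) * a ≡ + 18 * a * s - + 13 *
              ((+ 2 * p + + 4) * a)
        lemma₁ = solve-∀
        lemma₂ : ∀ w s a → + 18 * a * s - + 13 * (w * s) ≡ s * (+ 18 * a - + 13 * w)
        lemma₂ = solve-∀

    open Lines p p-prime 7≤p ω α (nat (m !)) ω-lower ω-upper

    0<Λ : 0ℤ < Λ
    0<Λ = +<+ (ℕ.n≢0⇒n>0 (ℕ.≢-nonZero⁻¹ (suc m !) {{suc m ℕ.!≢0}}))

    -- The coefficient -62 of q combines 31 + 52 from the diagonal `B x x` with -145 from `C x`.
    Y : ℕ → ℤ
    Y x = + 31 * (W + # (neg x) all) - + 52 * (# (τ x) all - # x all) - (+ 62 * Q + + 145)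

    at-symbol : ∀ {x} → InRange p x → lsum (B x) all + Q * B x x - C x * (1ℤ + Q) ≡ ω x * Y x
    at-symbol {x} rx = trans (cong₂ (λ s b → s + Q * b - C x * (1ℤ + Q)) (lsum-B all x) diagonal)
        (lemma (ω x) Q W (# (neg x) all) (# (τ x) all) (# x all))
      where
      f : ℤ → ℤ → ℤ → ℤ
      f n t s = ω x * + 31 * (1ℤ + n) + - (ω x * + 52) * (1ℤ * t + - 1ℤ * s)
      diagonal : B x x ≡ f 0ℤ 0ℤ 1ℤ
      diagonal = trans (cong (λ n → f n (eq (τ x) x) (eq x x)) (eq-≢ (neg-≢ rx)))
        (cong₂ (f 0ℤ) {eq (τ x) x} {0ℤ} {eq x x} {1ℤ} (eq-≢ (τ-≢ rx)) (eq-refl x))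
      lemma : ∀ w q W n t s → w * + 31 * (W + n) + - (w * + 52) * (1ℤ * t + - 1ℤ * s)
          + q * (w * + 31 * (1ℤ + 0ℤ) + - (w * + 52) * (1ℤ * 0ℤ + - 1ℤ * 1ℤ)) - w * + 145 * (1ℤ + q)
        ≡ w * (+ 31 * (W + n) - + 52 * (t - s) - (+ 62 * q + + 145))
      lemma = solve-∀

    R-# : R (λ x → # x all) ≡ W
    R-# = trans (R-cong _ (λ x → # x all * 1ℤ) (λ {x} _ → sym (ℤ.*-identityʳ (# x all)))) (sym (lsum-R one all range))

    -- Negation and x ↦ -2x permute the residues, so the class sizes at x, -x and -2x all sum to W
    -- and the terms with 52 cancel.
    R-Y : R Y ≡ (P - 1ℤ) * (+ 31 * W - (+ 62 * Q + + 145)) + + 31 * W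
    R-Y = begin
      R Y                                                  ≡⟨ R-cong Y (λ x → K + g x) (λ {x} _ → lemma₁ W Q (#
            (neg x) all) (# (τ x) all) (# x all)) ⟩
      R (λ x → K + g x)                                    ≡⟨ R-+ (λ _ → K) g ⟩
      R (λ _ → K) + R g                                    ≡⟨ cong₂ _+_ (R-const K) (R-+ (λ x → + 31 * #
            (neg x) all) h) ⟩
      (P - 1ℤ) * K + (R (λ x → + 31 * # (neg x) all) + R h) ≡⟨ cong₂ (λ s t → (P - 1ℤ) * K + (s + t)) R-opposite R-h ⟩
      (P - 1ℤ) * K + (+ 31 * W + (- + 52 * W + + 52 * W))  ≡⟨ lemma₂ ((P - 1ℤ) * K) W ⟩
      (P - 1ℤ) * K + + 31 * W                              ∎
      where
      open ≡-Reasoning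
      K : ℤ
      K = + 31 * W - (+ 62 * Q + + 145)
      g h : ℕ → ℤ
      h x = - + 52 * # (τ x) all + + 52 * # x all
      g x = + 31 * # (neg x) all + h x
      R-opposite : R (λ x → + 31 * # (neg x) all) ≡ + 31 * W
      R-opposite = trans (R-* (+ 31) (λ x → # (neg x) all)) (cong (_*_ (+ 31)) (trans (R-neg (λ x → # x all)) R-#))
      R-h : R h ≡ - + 52 * W + + 52 * W
      R-h = trans (R-+ (λ x → - + 52 * # (τ x) all) (λ x → + 52 * # x all)) (cong₂ _+_
        (trans (R-* (- + 52) (λ x → # (τ x) all)) (cong (_*_ (- + 52)) (trans (R-τ (λ x → # x all)) R-#)))
        (trans (R-* (+ 52) (λ x → # x all)) (cong (_*_ (+ 52)) R-#)))
      lemma₁ : ∀ w q n t s → + 31 * (w + n) - + 52 * (t - s) - (+ 62 * q + + 145)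
        ≡ (+ 31 * w - (+ 62 * q + + 145)) + (+ 31 * n + (- + 52 * t + + 52 * s))
      lemma₁ = solve-∀
      lemma₂ : ∀ a w → a + (+ 31 * w + (- + 52 * w + + 52 * w)) ≡ a + + 31 * w
      lemma₂ = solve-∀

    -- A class of size s_x and weight ω_x enters with s_x ω_x = Λ, the same for every symbol. This
    -- is what the weights are chosen for.
    ΛRY : lsum (λ x → lsum (B x) all + Q * B x x - C x * (1ℤ + Q)) all ≡ Λ * R Y
    ΛRY = trans (lsum-cong all (λ x∈ → at-symbol (range x∈))) (trans (lsum-R (λ x → ω x * Y x) all range)
      (trans (R-cong _ (λ x → Λ * Y x) (λ {x} rx → trans (lemma (# x all) (ω x) (Y x)) (cong (_* Y x)
            (ω-size rx)))) (R-* Λ Y)))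
      where
      lemma : ∀ s w y → s * (w * y) ≡ w * s * y
      lemma = solve-∀

    impossible : ⊥
    impossible = ℤ.≤⇒≯ (subst (_≤_ 0ℤ) (trans (contra P Q W) (vanish (- + 2) (+ 62)))
        (nonNeg-+ (nonNeg-+ (subst (_≤_ 0ℤ) R-Y 0≤RY) (nonNeg-* (nonNeg-* (nat 31) (ℤ.<⇒≤ 0<P)) slack))
              (nonNeg-* (nat 21) 0≤P-7))) -<+
      where
      0≤RY : 0ℤ ≤ R Y
      0≤RY = nonNeg-cancel Λ 0<Λ (subst (_≤_ 0ℤ) ΛRY (allLines B C (λ xs zs →
        subst (_≤_ 0ℤ) (sym (lsum-cong xs (λ {x} _ → B-value xs x))) (line-inequality xs zs))))
      -- 31 p copies of the weight bound reduce the total to 145 - 21 p, and 21 copies of p ≥ 7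
      -- leave -2.
      contra : ∀ p q w → (p - 1ℤ) * (+ 31 * w - (+ 62 * q + + 145)) + + 31 * w + + 31 * p *
            (+ 2 * q - + 2 * p + + 4 - w) + + 21 * (p - + 7)
        ≡ - + 2 + (q - p * p) * + 62
      contra = solve-∀

  -- Return to code words.

  three-symbols : ∀ {xs a b c} → a ∈ xs → b ∈ xs → c ∈ xs → a ≢ b → a ≢ c → b ≢ c →
    ∀ x y → ∃[ z ] (z ∈ xs × z ≢ x × z ≢ y)
  three-symbols {a = a} {b} {c} a∈ b∈ c∈ a≢b a≢c b≢c x y with a ℕ.≟ x | a ℕ.≟ y | b ℕ.≟ x | b ℕ.≟ y
  ... | no a≢x   | no a≢y   | _        | _        = a , a∈ , a≢x , a≢y
  ... | _        | _        | no b≢x   | no b≢y   = b , b∈ , b≢x , b≢y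
  ... | yes refl | _        | yes b≡x  | _        = contradiction (sym b≡x) a≢b
  ... | _        | yes refl | _        | yes b≡y  = contradiction (sym b≡y) a≢b
  ... | yes refl | _        | _        | yes refl = c , c∈ , a≢c ∘ sym , b≢c ∘ sym
  ... | _        | yes refl | yes refl | _        = c , c∈ , b≢c ∘ sym , a≢c ∘ sym

  -- The truncated subtraction is exact because 2 p ≤ 2 p².
  light-word : ∀ p .{{_ : ℕ.NonZero p}} {w} → w ℕ.≤ 2 ℕ.* (p ℕ.* p) ℕ.∸ 2 ℕ.* p ℕ.+ 4 →
    + w ≤ + 2 * + (p ℕ.* p) - + 2 * + p + + 4
  light-word p {w} small = subst (+ w ≤_) bound (+≤+ small)
    where
    bound : + (2 ℕ.* (p ℕ.* p) ℕ.∸ 2 ℕ.* p ℕ.+ 4) ≡ + 2 * + (p ℕ.* p) - + 2 * + p + + 4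
    bound = trans (ℤ.pos-+ (2 ℕ.* (p ℕ.* p) ℕ.∸ 2 ℕ.* p) 4) (cong (_+ + 4)
      (trans (sym (trans (ℤ.m-n≡m⊖n (2 ℕ.* (p ℕ.* p)) (2 ℕ.* p)) (ℤ.⊖-≥ (ℕ.*-monoʳ-≤ 2 (ℕ.m≤m*n p p)))))
        (cong₂ _-_ (ℤ.pos-* 2 (p ℕ.* p)) (ℤ.pos-* 2 p))))

  no-third-symbol : ∀ {p} (p-prime : Prime p) → 7 ℕ.≤ p → (Π : ProjectivePlane (p ℕ.* p)) →
    ∀ c → InDual Π p c → weight c ℕ.≤ 2 ℕ.* (p ℕ.* p) ℕ.∸ 2 ℕ.* p ℕ.+ 4 → ¬ UsesMoreThanTwoSymbols c
  no-third-symbol {p} p-prime 7≤p Π c c⊥ small (A , B , C , a≢0 , b≢0 , c≢0 , a≢b , a≢c , b≢c) =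
    Contradiction.impossible p p-prime 7≤p all all-range pencil allLines (subst (_≤ _) lsum-one (light-word p small))
      (λ x → three-symbols (∈-all⁺ A a≢0) (∈-all⁺ B b≢0) (∈-all⁺ C c≢0)
        (a≢b ∘ Fin.toℕ-injective) (a≢c ∘ Fin.toℕ-injective) (b≢c ∘ Fin.toℕ-injective) x (p ℕ.∸ x))
    where
    instance
      p≢0 : ℕ.NonZero p
      p≢0 = prime⇒nonZero p-prime
    open Code Π c c⊥

open import Data.Nat using (ℕ; _+_; _*_; _∸_; _≤_)
open import Data.Nat.Primality using (Prime)
open import Data.Fin using (Fin)
open import Data.Product using (_×_; _,_)
open import Relation.Nullary using (¬_)

mainTheorem4 : (p : ℕ) → Prime p → 7 ≤ p →
    (Π : ProjectivePlane (p * p)) →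
    (c : Fin (numPts (p * p)) → Fin p) →
    InDual Π p c →
    ¬ (NonZeroWord c × weight c ≤ 2 * (p * p) ∸ 2 * p + 4 × UsesMoreThanTwoSymbols c)
mainTheorem4 p p-prime 7≤p Π c c⊥ (_ , small , symbols) =
  DualWord.no-third-symbol p-prime 7≤p Π c c⊥ small symbols
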